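{- Let $\mu=(\mu_1,\dots,\mu_k)\vdash n$ and $a=(a_1,\dots,a_h)\vDash n$ with $\mu\unrhd\lambda(a)$. Let $r\in R(\mu,a)$ with $r\le s(\mu,a)$. Define $a^i$, $l_i$, $\mu^i$ inductively by $a^0=a$, $l_0=r$, $\mu^0=\mu$, and for $0\le i<n$: $$a^{i+1}=\widetilde{a^i},\qquad l_{i+1}=\begin{cases} l(\mu^i,a^i,1)&\text{if } i\in A,\\ l(\mu^i,a^i,l_i)&\text{otherwise},\end{cases}\qquad \mu^{i+1}=(\mu^i)^{(l_{i+1})},$$ where $A=\{a_h,\ a_h+a_{h-1},\ \dots,\ a_h+a_{h-1}+\cdots+a_2\}$ (under the hypotheses these are well defined). Define a tableau $S$ of shape $\mu$ and weight $a$ by $S(l_{i+1},\mu^i_{l_{i+1}})=t$ for $0\le i<n$, where $t$ is determined by $\sum_{j=1}^{t-1}a_j<n-i\le\sum_{j=1}^t a_j$. Then $S$ is the least element of the subposet $$\{T\in\mathrm{STab}(\mu,a): \min\{i: T(i,\mu_i)=h\}\ge r\}$$ of $(\mathrm{STab}(\mu,a),\le)$. In particular, if $r=l(\mu,a)$, then $S$ is the least element of $\mathrm{STab}(\mu,a)$.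
   Context: A composition of $n$ is a sequence $a=(a_1,\dots,a_h)$ of positive integers with $\sum a_i=n$ (written $a\vDash n$); $h=h(a)$ is its height. A partition of $n$ ($\mu\vdash n$) is a non-increasing composition; by convention $\mu_i=0$ beyond its number of parts, and sequences with trailing zeros are identified with the partition obtained by deleting them. For compositions $a=(a_1,\dots,a_h)$, $b=(b_1,\dots,b_k)$ of $n$, $a\unrhd b$ means $k\ge h$ and $\sum_{i=1}^j a_i\ge\sum_{i=1}^j b_i$ for $j=1,\dots,h$; $a\rhd b$ means $a\unrhd b$, $a\neq b$. $\lambda(a)$ is the non-increasing rearrangement of $a$. For a sequence $c$ and index $i$, $c^{(i)}$ is $c$ with its $i$-th entry decreased by $1$. $\tilde a=(a_1,\dots,a_{h-1},a_h-1)$ if $a_h\ge2$ and $\tilde a=(a_1,\dots,a_{h-1})$ if $a_h=1$. $D_\mu=\{(i,j):1\le i\le k,1\le j\le \mu_i\}$. $\mathrm{STab}(\mu,a)$ is the set of maps $T:D_\mu\to\{1,\dots,h\}$ with weakly increasing rows ($T(i,j)\le T(i,j+1)$), strictly increasing columns ($T(i,j)<T(i+1,j)$) and $|T^{ -1}(\{i\})|=a_i$ for all $i$. $s(\mu,a)=\max\{i:\mu_i\ge a_h\}$. $R(\mu,a)$ is the set of $i\in\{1,\dots,k\}$ such that $\mu_i>\mu_{i+1}$ and $\mu^{(i)}\unrhd\lambda(\tilde a)$; $l(\mu,a)=\min R(\mu,a)$; for $1\le i\le k$, $R(\mu,a,i)=\{r\in R(\mu,a): r\ge i\}$ and $l(\mu,a,i)=\min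 R(\mu,a,i)$. Partial order on $\mathrm{STab}(\mu,a)$: for $T,S$ and $1\le p\le h$ put $\tau^{(p)}=(|\{j:T(i,j)\le p\}|)_{i=1}^k$, $\sigma^{(p)}=(|\{j:S(i,j)\le p\}|)_{i=1}^k$; $S\le T$ iff $S=T$ or there is $p$ with $\tau^{(p')}=\sigma^{(p')}$ for all $p<p'\le h$ and $\tau^{(p)}\rhd\sigma^{(p)}$. -}

module Defs where

open import Data.Nat using (ℕ; zero; suc; _+_; _∸_; _≤_; _<_; _≤?_; _<?_; _≟_; _≡ᵇ_; _≤ᵇ_; _<ᵇ_)
import Data.Nat.Properties as ℕP
open import Data.Bool using (Bool; true; false; if_then_else_; _∧_)
open import Data.List using (List; []; _∷_; length; take; reverse; map; upTo; concatMap; filter)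
open import Data.Nat.ListAction using (sum)
open import Data.Bool.ListAction using (any)
open import Data.Maybe using (Maybe; just; nothing; fromMaybe)
open import Data.Fin using (Fin; toℕ)
import Data.Fin.Properties as FinP
open import Data.Product using (Σ; _×_; _,_; proj₁; proj₂)
open import Data.Sum using (_⊎_)
open import Relation.Binary.PropositionalEquality using (_≡_; _≢_)
open import Relation.Nullary using (Dec; does; ¬_)
open import Relation.Nullary.Decidable using (_×-dec_)
import Relation.Binary.Properties.DecTotalOrder as DTOP
import Data.List.Sort as Sort

-- Sequences of naturals are lists; indices are 1-based; entries beyond
-- the end are 0 (paper's convention μ_i = 0 beyond the number of parts).

get : List ℕ → ℕ → ℕ
get xs zero = 0
get [] (suc i) = 0
get (x ∷ xs) (suc zero) = x
get (x ∷ xs) (suc (suc i)) = get xs (suc i)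

range1 : ℕ → List ℕ
range1 m = map suc (upTo m)

-- delete trailing zeros (identification of sequences with trailing zeros)
strip : List ℕ → List ℕ
strip [] = []
strip (x ∷ xs) = cons' x (strip xs)
  where
  cons' : ℕ → List ℕ → List ℕ
  cons' zero [] = []
  cons' y ys = y ∷ ys

decAt : List ℕ → ℕ → List ℕ
decAt xs zero = xs
decAt [] (suc i) = []
decAt (x ∷ xs) (suc zero) = (x ∸ 1) ∷ xs
decAt (x ∷ xs) (suc (suc i)) = x ∷ decAt xs (suc i)

tilde : List ℕ → List ℕ
tilde [] = []
tilde (x ∷ []) with x
... | suc (suc y) = suc y ∷ []
... | _ = []
tilde (x ∷ y ∷ ys) = x ∷ tilde (y ∷ ys)

-- last entry a_h (0 for the empty list)
lastE : List ℕ → ℕ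
lastE xs = get xs (length xs)

module SortDesc = Sort (DTOP.≥-decTotalOrder ℕP.≤-decTotalOrder)

sortDesc : List ℕ → List ℕ
sortDesc = SortDesc.sort

IsComposition : ℕ → List ℕ → Set
IsComposition n a = (∀ i → 1 ≤ i → i ≤ length a → 1 ≤ get a i) × sum a ≡ n

IsPartition : ℕ → List ℕ → Set
IsPartition n μ = IsComposition n μ × (∀ i → 1 ≤ i → get μ (suc i) ≤ get μ i)

_⊵_ : List ℕ → List ℕ → Set
a ⊵ b = length a ≤ length b
      × ((j : Fin (length a)) → sum (take (suc (toℕ j)) b) ≤ sum (take (suc (toℕ j)) a))

_⊳_ : List ℕ → List ℕ → Set
a ⊳ b = a ⊵ b × a ≢ b

_⊵?_ : (a b : List ℕ) → Dec (a ⊵ b)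
a ⊵? b = (length a ≤? length b)
  ×-dec FinP.all? (λ j → sum (take (suc (toℕ j)) b) ≤? sum (take (suc (toℕ j)) a))

InR : List ℕ → List ℕ → ℕ → Set
InR μ a i = 1 ≤ i × i ≤ length μ × get μ (suc i) < get μ i
          × strip (decAt μ i) ⊵ sortDesc (tilde a)

InR? : (μ a : List ℕ) (i : ℕ) → Dec (InR μ a i)
InR? μ a i = (1 ≤? i) ×-dec (i ≤? length μ) ×-dec (get μ (suc i) <? get μ i)
           ×-dec (strip (decAt μ i) ⊵? sortDesc (tilde a))

InRFrom : List ℕ → List ℕ → ℕ → ℕ → Set
InRFrom μ a i r = InR μ a r × i ≤ r

firstFrom : (ℕ → Bool) → ℕ → ℕ → Maybe ℕ
firstFrom p s zero = nothing
firstFrom p s (suc f) = if p s then just s else firstFrom p (suc s) f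

lastUpTo : (ℕ → Bool) → ℕ → ℕ
lastUpTo p zero = 0
lastUpTo p (suc k) = if p (suc k) then suc k else lastUpTo p k

-- l(μ,a,i) = min R(μ,a,i)  (R(μ,a,i) ⊆ {i..k}; default 0 if empty, which the
-- theorem below proves never happens along the construction)
lmin : List ℕ → List ℕ → ℕ → ℕ
lmin μ a i = fromMaybe 0 (firstFrom (λ r → does (InR? μ a r)) i (suc (length μ) ∸ i))

sIdx : List ℕ → List ℕ → ℕ
sIdx μ a = lastUpTo (λ i → lastE a ≤ᵇ get μ i) (length μ)

inA : List ℕ → ℕ → Bool
inA a i = any (λ m → i ≡ᵇ sum (take m (reverse a))) (range1 (length a ∸ 1))

state : List ℕ → List ℕ → ℕ → ℕ → List ℕ × ℕ × List ℕ
state μ a r zero = a , r , μ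
state μ a r (suc i) with state μ a r i
... | ai , li , mi =
  let l' = if inA a i then lmin mi ai 1 else lmin mi ai li
  in tilde ai , l' , strip (decAt mi l')

aSeq : List ℕ → List ℕ → ℕ → ℕ → List ℕ
aSeq μ a r i = proj₁ (state μ a r i)

lSeq : List ℕ → List ℕ → ℕ → ℕ → ℕ
lSeq μ a r i = proj₁ (proj₂ (state μ a r i))

μSeq : List ℕ → List ℕ → ℕ → ℕ → List ℕ
μSeq μ a r i = proj₂ (proj₂ (state μ a r i))

tOf : List ℕ → ℕ → ℕ → ℕ
tOf a n i = fromMaybe 0 (firstFrom
  (λ t → (sum (take (t ∸ 1) a) <ᵇ n ∸ i) ∧ (n ∸ i ≤ᵇ sum (take t a))) 1 (length a))

-- Tableaux are maps ℕ → ℕ → ℕ (row, column), only their values on D_μ matter.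
Tableau : Set
Tableau = ℕ → ℕ → ℕ

-- S(l_{i+1}, μ^i_{l_{i+1}}) = t(i) for 0 ≤ i < n   (0 on cells not hit)
Stab : ℕ → List ℕ → List ℕ → ℕ → Tableau
Stab n μ a r row col = go 0 n
  where
  go : ℕ → ℕ → ℕ
  go i zero = 0
  go i (suc f) =
    if (lSeq μ a r (suc i) ≡ᵇ row) ∧ (get (μSeq μ a r i) (lSeq μ a r (suc i)) ≡ᵇ col)
    then tOf a n i else go (suc i) f

InD : List ℕ → ℕ → ℕ → Set
InD μ i j = 1 ≤ i × i ≤ length μ × 1 ≤ j × j ≤ get μ i

cells : List ℕ → List (ℕ × ℕ)
cells μ = concatMap (λ i → map (λ j → i , j) (range1 (get μ i))) (range1 (length μ))

countVal : List ℕ → Tableau → ℕ → ℕ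
countVal μ T p = length (filter (λ c → T (proj₁ c) (proj₂ c) ≟ p) (cells μ))

STab : List ℕ → List ℕ → Tableau → Set
STab μ a T =
    (∀ i j → InD μ i j → 1 ≤ T i j × T i j ≤ length a)
  × (∀ i j → InD μ i j → InD μ i (suc j) → T i j ≤ T i (suc j))
  × (∀ i j → InD μ i j → InD μ (suc i) j → T i j < T (suc i) j)
  × (∀ p → 1 ≤ p → p ≤ length a → countVal μ T p ≡ get a p)

tau : List ℕ → Tableau → ℕ → List ℕ
tau μ T p = strip (map (λ i → length (filter (λ j → T i j ≤? p) (range1 (get μ i))))
                       (range1 (length μ)))

TabLe : List ℕ → List ℕ → Tableau → Tableau → Set
TabLe μ a S T =
    (∀ i j → InD μ i j → S i j ≡ T i j)
  ⊎ Σ ℕ (λ p → 1 ≤ p × p ≤ length a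
       × (∀ p' → p < p' → p' ≤ length a → tau μ T p' ≡ tau μ S p')
       × tau μ T p ⊳ tau μ S p)

-- the subposet { T ∈ STab(μ,a) : min{ i : T(i,μ_i) = h } ≥ r }
SubTab : List ℕ → List ℕ → ℕ → Tableau → Set
SubTab μ a r T = STab μ a T
  × (∀ i → 1 ≤ i → i ≤ length μ → T i (get μ i) ≡ length a → r ≤ i)

IsLeast : List ℕ → List ℕ → (Tableau → Set) → Tableau → Set
IsLeast μ a P S = P S × (∀ T → P T → TabLe μ a S T)

{-# OPTIONS --safe #-}
module Submission where

-- Write top b j for the largest sum of j entries of b, so that μ ⊵ λ(b) says
-- that the partial sums of μ dominate top b.
--
-- Existence.  If μ ⊵ λ(a), the last row s of length at least a_h lies in R(μ,a).
-- If the current row l satisfies l ≤ s, then the next greedy row l′ satisfies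
-- l ≤ l′ ≤ s; after removing a cell from it, its length is still at least the
-- new last part, so the condition is preserved and the process never gets stuck.
--
-- Tableau.  A cell of S has entry ≤ p exactly when it survives in the shape
-- reached when the letters > p have been removed.  Within one letter the rows
-- weakly increase, so each letter occupies a horizontal strip.
--
-- Leastness.  Let T agree with S on the letters > p + 1, and let g be the shape
-- of the entries ≤ p of T.  While the greedy process removes letter p + 1, its
-- partial sums stay ≤ those of g before the current row: the first row where
-- this would fail is itself in R, contradicting the minimality of the choice.

open import Defs
open import Algebra.Properties.CommutativeSemigroup using (interchange)
open import Data.Bool using (Bool; true; false; if_then_else_; _∧_)
open import Data.Bool.ListAction using (any)
open import Data.Bool.Properties using (T-≡; T-∧; ∨-zeroʳ)
open import Data.Empty using (⊥)
open import Data.Fin using (toℕ; fromℕ<)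
open import Data.Fin.Properties using (toℕ-fromℕ<)
open import Data.List using (List; []; _∷_; _∷ʳ_; _++_; length; take; drop; reverse; map; upTo; applyUpTo; concatMap; filter)
open import Data.List.Membership.Propositional using (_∈_)
open import Data.List.Membership.Propositional.Properties using (∈-map⁺; ∈-map⁻; ∈-upTo⁺; ∈-upTo⁻)
open import Data.List.Properties using (take-all; take++drop≡id; length-drop; length-reverse; reverse-++; upTo-∷ʳ; map-upTo; length-upTo; map-++; map-∘; map-cong; length-map; filter-++; filter-accept; filter-reject; length-++; concatMap-++; ++-identityʳ; ≡-dec)
open import Data.List.Relation.Binary.Permutation.Propositional as Perm using (_↭_; ↭-sym)
open import Data.List.Relation.Binary.Permutation.Propositional.Properties using (∷↭∷ʳ; ↭-reverse)
open import Data.List.Relation.Unary.All using (All; []; _∷_)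
open import Data.List.Relation.Unary.AllPairs using (AllPairs; _∷_)
open import Data.List.Relation.Unary.Any using (here; there)
open import Data.List.Relation.Unary.Linked.Properties using (Linked⇒AllPairs)
open import Data.Maybe using (just)
open import Data.Nat using (ℕ; zero; suc; _+_; _∸_; _⊔_; _≤_; _<_; _≥_; _≤?_; _<?_; _≟_; _≡ᵇ_; _≤ᵇ_; _<ᵇ_; z≤n; s≤s; s≤s⁻¹)
open import Data.Nat.ListAction using (sum)
open import Data.Nat.ListAction.Properties using (sum-++; sum-↭)
open import Data.Nat.Properties
open import Data.Product using (∃-syntax; _×_; _,_; proj₁; proj₂)
open import Data.Sum using (_⊎_; inj₁; inj₂)
open import Function.Bundles using (_⇔_; mk⇔; Equivalence)
open import Relation.Binary.PropositionalEquality using (_≡_; _≢_; refl; sym; trans; cong; cong₂; subst; subst₂; module ≡-Reasoning)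
open import Relation.Nullary using (Dec; yes; no; does; ¬_; contradiction)

-- Partial sums

psum : (ℕ → ℕ) → ℕ → ℕ
psum f zero    = 0
psum f (suc j) = psum f j + f (suc j)

psum-mono : ∀ f {i j} → i ≤ j → psum f i ≤ psum f j
psum-mono f {i} {j} i≤j with m≤n⇒m<n∨m≡n i≤j
... | inj₂ refl = ≤-refl
psum-mono f {i} {suc j} i≤j | inj₁ (s≤s i≤j′) = ≤-trans (psum-mono f i≤j′) (m≤m+n _ _)

psum-cong : ∀ {f g} → (∀ i → 1 ≤ i → f i ≡ g i) → ∀ j → psum f j ≡ psum g j
psum-cong f≗g zero    = refl
psum-cong f≗g (suc j) = cong₂ _+_ (psum-cong f≗g j) (f≗g (suc j) (s≤s z≤n))

psum-get-∷ : ∀ x xs j → psum (get (x ∷ xs)) (suc j) ≡ x + psum (get xs) j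
psum-get-∷ x xs zero    = sym (+-identityʳ x)
psum-get-∷ x xs (suc j) = trans (cong (_+ get xs (suc j)) (psum-get-∷ x xs j)) (+-assoc x _ _)

psum-[] : ∀ j → psum (get []) j ≡ 0
psum-[] zero    = refl
psum-[] (suc j) = trans (+-identityʳ _) (psum-[] j)

sum-take : ∀ xs j → sum (take j xs) ≡ psum (get xs) j
sum-take xs       zero    = refl
sum-take []       (suc j) = sym (psum-[] (suc j))
sum-take (x ∷ xs) (suc j) = trans (cong (x +_) (sum-take xs j)) (sym (psum-get-∷ x xs j))

psum-all : ∀ xs {j} → length xs ≤ j → psum (get xs) j ≡ sum xs
psum-all xs {j} len≤j = trans (sym (sum-take xs j)) (cong sum (take-all j xs len≤j))

psum≤sum : ∀ xs j → psum (get xs) j ≤ sum xs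
psum≤sum xs j with ≤-total (length xs) j
... | inj₁ le = ≤-reflexive (psum-all xs le)
... | inj₂ ge = ≤-trans (psum-mono (get xs) ge) (≤-reflexive (psum-all xs ≤-refl))

get-beyond : ∀ xs i → length xs < i → get xs i ≡ 0
get-beyond []       (suc i)       _        = refl
get-beyond (x ∷ xs) (suc (suc i)) (s≤s lt) = get-beyond xs (suc i) lt

get≥1⇒≤length : ∀ xs i → 1 ≤ get xs i → i ≤ length xs
get≥1⇒≤length xs i pos with i ≤? length xs
... | yes le = le
... | no  gt = contradiction (subst (1 ≤_) (get-beyond xs i (≰⇒> gt)) pos) λ ()

get-strip : ∀ xs i → get (strip xs) i ≡ get xs i
get-strip []       i = refl
get-strip (x ∷ xs) zero = refl
get-strip (x ∷ xs) (suc i) with strip xs | get-strip xs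
get-strip (zero  ∷ xs) (suc zero)    | []     | ih = refl
get-strip (zero  ∷ xs) (suc (suc i)) | []     | ih = ih (suc i)
get-strip (zero  ∷ xs) (suc zero)    | y ∷ ys | ih = refl
get-strip (zero  ∷ xs) (suc (suc i)) | y ∷ ys | ih = ih (suc i)
get-strip (suc x ∷ xs) (suc zero)    | ys     | ih = refl
get-strip (suc x ∷ xs) (suc (suc i)) | ys     | ih = ih (suc i)

lastE-strip : ∀ xs → 1 ≤ length (strip xs) → 1 ≤ lastE (strip xs)
lastE-strip (x ∷ xs) len with strip xs | lastE-strip xs
lastE-strip (zero  ∷ xs) () | []     | ih
lastE-strip (zero  ∷ xs) len | y ∷ ys | ih = ih (s≤s z≤n)
lastE-strip (suc x ∷ xs) len | []     | ih = s≤s z≤n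
lastE-strip (suc x ∷ xs) len | y ∷ ys | ih = ih (s≤s z≤n)

sum-strip : ∀ xs → sum (strip xs) ≡ sum xs
sum-strip []       = refl
sum-strip (x ∷ xs) with strip xs | sum-strip xs
sum-strip (zero  ∷ xs) | []     | ih = ih
sum-strip (zero  ∷ xs) | y ∷ ys | ih = ih
sum-strip (suc x ∷ xs) | ys     | ih = cong (suc x +_) ih

Positive : List ℕ → Set
Positive xs = ∀ i → 1 ≤ i → i ≤ length xs → 1 ≤ get xs i

Antitone : (ℕ → ℕ) → Set
Antitone f = ∀ i → 1 ≤ i → f (suc i) ≤ f i

antitone-≤ : ∀ {f} → Antitone f → ∀ {i j} → 1 ≤ i → i ≤ j → f j ≤ f i
antitone-≤ anti {i} {j} 1≤i i≤j with m≤n⇒m<n∨m≡n i≤j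
... | inj₂ refl = ≤-refl
antitone-≤ anti {i} {suc j} 1≤i i≤j | inj₁ (s≤s i≤j′) =
  ≤-trans (anti j (≤-trans 1≤i i≤j′)) (antitone-≤ anti 1≤i i≤j′)

-- The last entry that survives stripping is positive, and in a weakly decreasing sequence it bounds
-- every earlier entry from below.
strip-positive : ∀ xs → Antitone (get xs) → Positive (strip xs)
strip-positive xs anti i 1≤i i≤len = ≤-trans (lastE-strip xs (≤-trans 1≤i i≤len))
  (antitone-≤ (λ j 1≤j → subst₂ _≤_ (sym (get-strip xs (suc j))) (sym (get-strip xs j)) (anti j 1≤j)) 1≤i i≤len)

-- Dominance in terms of partial sums

-- The definition only compares sums up to the length of `a`. Past that length the sum over `a` is
-- complete and bounds the total of `b`.
⊵-elim : ∀ {a b} → sum b ≤ sum a → a ⊵ b → ∀ j → psum (get b) j ≤ psum (get a) j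
⊵-elim {a} {b} sb≤sa (_ , dom) zero    = z≤n
⊵-elim {a} {b} sb≤sa (_ , dom) (suc j) with j <? length a
... | yes j<len = subst₂ _≤_ (sum-take b (suc j)) (sum-take a (suc j))
        (subst (λ m → sum (take (suc m) b) ≤ sum (take (suc m) a)) (toℕ-fromℕ< j<len) (dom (fromℕ< j<len)))
... | no  j≮len = begin
    psum (get b) (suc j)  ≤⟨ psum≤sum b (suc j) ⟩
    sum b                 ≤⟨ sb≤sa ⟩
    sum a                 ≡⟨ psum-all a (m≤n⇒m≤1+n (≮⇒≥ j≮len)) ⟨
    psum (get a) (suc j)  ∎
  where open ≤-Reasoning

-- Positivity gives the length condition: if `b` were shorter, `a` would already have reached the
-- common total after `length b` entries, with a positive entry still to come.
⊵-intro : ∀ {a b} → Positive a → sum a ≡ sum b → (∀ j → psum (get b) j ≤ psum (get a) j) → a ⊵ b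
⊵-intro {a} {b} pos sa≡sb dom = len≤ , λ j → let m = suc (toℕ j) in
  subst₂ _≤_ (sym (sum-take b m)) (sym (sum-take a m)) (dom m)
  where
  open ≤-Reasoning
  len≤ : length a ≤ length b
  len≤ with length a ≤? length b
  ... | yes le = le
  ... | no  gt = contradiction (begin-strict
    sum b                        ≡⟨ psum-all b ≤-refl ⟨
    psum (get b) (length b)      ≤⟨ dom (length b) ⟩
    psum (get a) (length b)      <⟨ m<m+n _ (pos (suc (length b)) (s≤s z≤n) (≰⇒> gt)) ⟩
    psum (get a) (suc (length b)) ≤⟨ psum≤sum a _ ⟩
    sum a                        ≡⟨ sa≡sb ⟩
    sum b                        ∎) (<-irrefl refl)

-- The largest sum of j entries

top : List ℕ → ℕ → ℕ
top xs       zero    = 0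
top []       (suc j) = 0
top (x ∷ xs) (suc j) = top xs (suc j) ⊔ (x + top xs j)

top-∷ : ∀ x xs j → top xs j ≤ top (x ∷ xs) j
top-∷ x xs zero    = z≤n
top-∷ x xs (suc j) = m≤m⊔n _ _

top-pick : ∀ x xs j → x + top xs j ≤ top (x ∷ xs) (suc j)
top-pick x xs j = m≤n⊔m (top xs (suc j)) _

top-head-mono : ∀ {x y} xs → x ≤ y → ∀ j → top (x ∷ xs) j ≤ top (y ∷ xs) j
top-head-mono xs x≤y zero    = z≤n
top-head-mono xs x≤y (suc j) = ⊔-mono-≤ ≤-refl (+-monoˡ-≤ _ x≤y)

top-suc : ∀ xs j → top xs j ≤ top xs (suc j)
top-suc xs       zero    = z≤n
top-suc []       (suc j) = z≤n
top-suc (x ∷ xs) (suc j) = ⊔-mono-≤ (top-suc xs (suc j)) (+-monoʳ-≤ x (top-suc xs j))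

top-0∷ : ∀ xs j → top (0 ∷ xs) j ≡ top xs j
top-0∷ xs zero    = refl
top-0∷ xs (suc j) = m≥n⇒m⊔n≡m (top-suc xs j)

top-∷∷ : ∀ x y xs j → top (x ∷ y ∷ xs) (suc (suc j)) ≡
  (top xs (suc (suc j)) ⊔ (y + top xs (suc j))) ⊔ ((x + top xs (suc j)) ⊔ (x + y + top xs j))
top-∷∷ x y xs j = cong (top (y ∷ xs) (suc (suc j)) ⊔_)
  (trans (+-distribˡ-⊔ x (top xs (suc j)) _) (cong ((x + top xs (suc j)) ⊔_) (sym (+-assoc x y _))))

top-swap : ∀ x y xs j → top (x ∷ y ∷ xs) j ≡ top (y ∷ x ∷ xs) j
top-swap x y xs zero          = refl
top-swap x y xs (suc zero)    = begin
  (t ⊔ (y + 0)) ⊔ (x + 0)  ≡⟨ ⊔-assoc t _ _ ⟩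
  t ⊔ ((y + 0) ⊔ (x + 0))  ≡⟨ cong (t ⊔_) (⊔-comm (y + 0) _) ⟩
  t ⊔ ((x + 0) ⊔ (y + 0))  ≡⟨ ⊔-assoc t _ _ ⟨
  (t ⊔ (x + 0)) ⊔ (y + 0)  ∎
  where
  open ≡-Reasoning
  t = top xs 1
top-swap x y xs (suc (suc j)) = begin
  top (x ∷ y ∷ xs) (suc (suc j))                        ≡⟨ top-∷∷ x y xs j ⟩
  (t ⊔ (y + u)) ⊔ ((x + u) ⊔ (x + y + top xs j))        ≡⟨ interchange ⊔-commutativeSemigroup t (y + u) (x + u) _ ⟩
  (t ⊔ (x + u)) ⊔ ((y + u) ⊔ (x + y + top xs j))        ≡⟨ cong (λ s → (t ⊔ (x + u)) ⊔ ((y + u) ⊔ (s + top xs j))) (+-comm x y) ⟩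
  (t ⊔ (x + u)) ⊔ ((y + u) ⊔ (y + x + top xs j))        ≡⟨ top-∷∷ y x xs j ⟨
  top (y ∷ x ∷ xs) (suc (suc j))                        ∎
  where
  open ≡-Reasoning
  t = top xs (suc (suc j))
  u = top xs (suc j)

top-prep : ∀ x {xs ys} → (∀ j → top xs j ≡ top ys j) → ∀ j → top (x ∷ xs) j ≡ top (x ∷ ys) j
top-prep x eq zero    = refl
top-prep x eq (suc j) = cong₂ _⊔_ (eq (suc j)) (cong (x +_) (eq j))

top-↭ : ∀ {xs ys} → xs ↭ ys → ∀ j → top xs j ≡ top ys j
top-↭ Perm.refl                        j = refl
top-↭ (Perm.prep x p)                  j = top-prep x (top-↭ p) j
top-↭ (Perm.swap {xs = xs} x y p)      j =
  trans (top-swap x y xs j) (top-prep y (top-prep x (top-↭ p)) j)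
top-↭ (Perm.trans p q)                j = trans (top-↭ p j) (top-↭ q j)

-- Drop any one of the chosen entries; it is at most `x`.
top-bounded : ∀ {x xs} → All (_≤ x) xs → ∀ j → top xs (suc j) ≤ x + top xs j
top-bounded []                          j = z≤n
top-bounded {x} {y ∷ ys} (y≤x ∷ ys≤x)   j = ⊔-lub
  (≤-trans (top-bounded ys≤x j) (+-monoʳ-≤ x (top-∷ y ys j)))
  (+-mono-≤ y≤x (top-∷ y ys j))

top-descending : ∀ {xs} → AllPairs _≥_ xs → ∀ j → sum (take j xs) ≡ top xs j
top-descending xs↘                zero    = refl
top-descending {[]} xs↘           (suc j) = refl
top-descending {x ∷ xs} (p ∷ xs↘) (suc j) = trans (cong (x +_) (top-descending xs↘ j))
  (sym (m≤n⇒m⊔n≡n (top-bounded p j)))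

-- Prefixes of a descending list are best choices, and `top` ignores order. This trades sorting for
-- `top`, whose recursion isolates one part.
psum-sortDesc : ∀ a j → psum (get (sortDesc a)) j ≡ top a j
psum-sortDesc a j = begin
  psum (get (sortDesc a)) j  ≡⟨ sum-take (sortDesc a) j ⟨
  sum (take j (sortDesc a))  ≡⟨ top-descending (Linked⇒AllPairs (λ p q → ≤-trans q p) (SortDesc.sort-↗ a)) j ⟩
  top (sortDesc a) j         ≡⟨ top-↭ (SortDesc.sort-↭ a) j ⟩
  top a j                    ∎
  where open ≡-Reasoning

sum-sortDesc : ∀ a → sum (sortDesc a) ≡ sum a
sum-sortDesc a = sum-↭ (SortDesc.sort-↭ a)

-- The last part of a composition

top-∷ʳ : ∀ b y j → top (b ∷ʳ y) j ≡ top (y ∷ b) j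
top-∷ʳ b y = top-↭ (↭-sym (∷↭∷ʳ y b))

sum-∷ʳ : ∀ b y → sum (b ∷ʳ y) ≡ y + sum b
sum-∷ʳ b y = sum-↭ (↭-sym (∷↭∷ʳ y b))

-- A last part 0 stands for a deleted part, so both cases of `tilde` become the single step from
-- `suc z` to `z`.
_∷ʳ⁺_ : List ℕ → ℕ → List ℕ
b ∷ʳ⁺ zero  = b
b ∷ʳ⁺ suc z = b ∷ʳ suc z

tilde-∷ʳ : ∀ b z → tilde (b ∷ʳ suc z) ≡ b ∷ʳ⁺ z
tilde-∷ʳ []          zero    = refl
tilde-∷ʳ []          (suc z) = refl
tilde-∷ʳ (x ∷ [])    zero    = refl
tilde-∷ʳ (x ∷ [])    (suc z) = refl
tilde-∷ʳ (x ∷ y ∷ b) zero    = cong (x ∷_) (tilde-∷ʳ (y ∷ b) zero)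
tilde-∷ʳ (x ∷ y ∷ b) (suc z) = cong (x ∷_) (tilde-∷ʳ (y ∷ b) (suc z))

top-∷ʳ⁺ : ∀ b z j → top (b ∷ʳ⁺ z) j ≡ top (z ∷ b) j
top-∷ʳ⁺ b zero    j = sym (top-0∷ b j)
top-∷ʳ⁺ b (suc z) j = top-∷ʳ b (suc z) j

sum-∷ʳ⁺ : ∀ b z → sum (b ∷ʳ⁺ z) ≡ z + sum b
sum-∷ʳ⁺ b zero    = refl
sum-∷ʳ⁺ b (suc z) = sum-∷ʳ b (suc z)

-- Since `top` is insensitive to order and to zeros, the lowered last part can be kept at the front,
-- even when it is 0.
psum-sort-tilde : ∀ b z j → psum (get (sortDesc (tilde (b ∷ʳ suc z)))) j ≡ top (z ∷ b) j
psum-sort-tilde b z j = trans (psum-sortDesc (tilde (b ∷ʳ suc z)) j)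
  (trans (cong (λ c → top c j) (tilde-∷ʳ b z)) (top-∷ʳ⁺ b z j))

sum-sort-tilde : ∀ b z → sum (sortDesc (tilde (b ∷ʳ suc z))) ≡ z + sum b
sum-sort-tilde b z = trans (sum-sortDesc (tilde (b ∷ʳ suc z)))
  (trans (cong sum (tilde-∷ʳ b z)) (sum-∷ʳ⁺ b z))

-- Removing a cell

record Decrement (f : ℕ → ℕ) (l : ℕ) (g : ℕ → ℕ) : Set where
  field
    row≥1 : 1 ≤ l
    at    : suc (g l) ≡ f l
    off   : ∀ i → i ≢ l → g i ≡ f i

  below : ∀ j → j < l → psum g j ≡ psum f j
  below zero    _   = refl
  below (suc j) j<l = cong₂ _+_ (below j (<-trans (n<1+n j) j<l)) (off (suc j) (<⇒≢ j<l))

  above : ∀ j → l ≤ j → suc (psum g j) ≡ psum f j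
  above zero    l≤j = contradiction (≤-trans row≥1 l≤j) λ ()
  above (suc j) l≤j with m≤n⇒m<n∨m≡n l≤j
  ... | inj₁ (s≤s l≤j′) = cong₂ _+_ (above j l≤j′) (off (suc j) λ eq → <⇒≢ (s≤s l≤j′) (sym eq))
  ... | inj₂ refl = trans (sym (+-suc (psum g j) (g (suc j)))) (cong₂ _+_ (below j (n<1+n j)) at)

  ≤-pointwise : ∀ i → g i ≤ f i
  ≤-pointwise i with i ≟ l
  ... | yes refl = ≤-trans (n≤1+n _) (≤-reflexive at)
  ... | no  i≢l  = ≤-reflexive (off i i≢l)

  antitone : Antitone f → f (suc l) < f l → Antitone g
  antitone anti corner i 1≤i with i ≟ l
  ... | yes refl = ≤-trans (≤-pointwise (suc i)) (s≤s⁻¹ (≤-trans corner (≤-reflexive (sym at))))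
  ... | no  i≢l  = ≤-trans (≤-pointwise (suc i)) (≤-trans (anti i 1≤i) (≤-reflexive (sym (off i i≢l))))

decAt-Decrement : ∀ xs l → 1 ≤ l → 1 ≤ get xs l → Decrement (get xs) l (get (decAt xs l))
decAt-Decrement xs l 1≤l pos = record { row≥1 = 1≤l ; at = at xs l 1≤l pos ; off = off xs l }
  where
  at : ∀ xs l → 1 ≤ l → 1 ≤ get xs l → suc (get (decAt xs l) l) ≡ get xs l
  at (suc x ∷ xs) (suc zero)    _ _   = refl
  at (x ∷ xs)     (suc (suc l)) _ pos = at xs (suc l) (s≤s z≤n) pos
  off : ∀ xs l i → i ≢ l → get (decAt xs l) i ≡ get xs i
  off xs       zero          i             _   = refl
  off []       (suc l)       i             _   = refl
  off (x ∷ xs) (suc zero)    zero          _   = refl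
  off (x ∷ xs) (suc zero)    (suc zero)    i≢l = contradiction refl i≢l
  off (x ∷ xs) (suc zero)    (suc (suc i)) _   = refl
  off (x ∷ xs) (suc (suc l)) zero          _   = refl
  off (x ∷ xs) (suc (suc l)) (suc zero)    _   = refl
  off (x ∷ xs) (suc (suc l)) (suc (suc i)) i≢l = off xs (suc l) (suc i) (λ eq → i≢l (cong suc eq))

strip-Decrement : ∀ {f l} xs → Decrement f l (get xs) → Decrement f l (get (strip xs))
strip-Decrement {l = l} xs d = record
  { row≥1 = row≥1
  ; at    = trans (cong suc (get-strip xs l)) at
  ; off   = λ i i≢l → trans (get-strip xs i) (off i i≢l)
  } where open Decrement d

sum-decAt : ∀ xs l → 1 ≤ l → 1 ≤ get xs l → suc (sum (decAt xs l)) ≡ sum xs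
sum-decAt (suc x ∷ xs) (suc zero)    _ _   = refl
sum-decAt (x ∷ xs)     (suc (suc l)) _ pos =
  trans (sym (+-suc x _)) (cong (x +_) (sum-decAt xs (suc l) (s≤s z≤n) pos))

get-decAt-≤ : ∀ xs l i → get (decAt xs l) i ≤ get xs i
get-decAt-≤ xs       zero          i             = ≤-refl
get-decAt-≤ []       (suc l)       i             = ≤-refl
get-decAt-≤ (x ∷ xs) (suc zero)    zero          = ≤-refl
get-decAt-≤ (x ∷ xs) (suc zero)    (suc zero)    = m∸n≤m x 1
get-decAt-≤ (x ∷ xs) (suc zero)    (suc (suc i)) = ≤-refl
get-decAt-≤ (x ∷ xs) (suc (suc l)) zero          = ≤-refl
get-decAt-≤ (x ∷ xs) (suc (suc l)) (suc zero)    = ≤-refl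
get-decAt-≤ (x ∷ xs) (suc (suc l)) (suc (suc i)) = get-decAt-≤ xs (suc l) (suc i)

-- The set R(μ,a)

-- Dominance of a partition over the sorted rearrangement of `b`, in a form that tolerates zeros and
-- any order in `b`. The part being removed is kept at the head of `b`.
record _≽_ (ρ b : List ℕ) : Set where
  field
    positive  : Positive ρ
    antitone  : Antitone (get ρ)
    size      : sum ρ ≡ sum b
    dominates : ∀ j → top b j ≤ psum (get ρ) j

-- Here `b` is the weight after the removal. The loss of a cell in row `l` lowers exactly the
-- partial sums from `l` on by one, so strict inequality is asked there and nothing before.
Removable : (ℕ → ℕ) → List ℕ → ℕ → Set
Removable f b l = 1 ≤ l × f (suc l) < f l × (∀ j → l ≤ j → top b j < psum f j)

removable⇒InR : ∀ {ρ b z l} → ρ ≽ (suc z ∷ b) → Removable (get ρ) (z ∷ b) l → InR ρ (b ∷ʳ suc z) l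
removable⇒InR {ρ} {b} {z} {l} ρ≽ (1≤l , corner , dom) =
  1≤l , get≥1⇒≤length ρ l pos , corner ,
  ⊵-intro (strip-positive (decAt ρ l) (D.antitone antitone corner)) sizes dom′
  where
  open _≽_ ρ≽
  pos : 1 ≤ get ρ l
  pos = ≤-trans (s≤s z≤n) corner
  module D = Decrement (decAt-Decrement ρ l 1≤l pos)
  module D′ = Decrement (strip-Decrement (decAt ρ l) (decAt-Decrement ρ l 1≤l pos))
  sizes : sum (strip (decAt ρ l)) ≡ sum (sortDesc (tilde (b ∷ʳ suc z)))
  sizes = suc-injective (begin
    suc (sum (strip (decAt ρ l)))  ≡⟨ cong suc (sum-strip (decAt ρ l)) ⟩
    suc (sum (decAt ρ l))          ≡⟨ sum-decAt ρ l 1≤l pos ⟩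
    sum ρ                          ≡⟨ size ⟩
    suc (z + sum b)                ≡⟨ cong suc (sum-sort-tilde b z) ⟨
    suc (sum (sortDesc (tilde (b ∷ʳ suc z)))) ∎)
    where open ≡-Reasoning
  dom′ : ∀ j → psum (get (sortDesc (tilde (b ∷ʳ suc z)))) j ≤ psum (get (strip (decAt ρ l))) j
  dom′ j = ≤-trans (≤-reflexive (psum-sort-tilde b z j)) (split (j <? l))
    where
    split : Dec (j < l) → top (z ∷ b) j ≤ psum (get (strip (decAt ρ l))) j
    -- Before row `l` the partial sums of the shape are unchanged, while the weight has only become
    -- smaller.
    split (yes j<l) = ≤-trans (top-head-mono b (n≤1+n z) j)
      (≤-trans (dominates j) (≤-reflexive (sym (D′.below j j<l))))
    split (no j≮l)  = s≤s⁻¹ (≤-trans (dom j (≮⇒≥ j≮l)) (≤-reflexive (sym (D′.above j (≮⇒≥ j≮l)))))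

InR-Decrement : ∀ {ρ a l} → InR ρ a l → Decrement (get ρ) l (get (strip (decAt ρ l)))
InR-Decrement {ρ} {a} {l} (1≤l , _ , corner , _) =
  strip-Decrement (decAt ρ l) (decAt-Decrement ρ l 1≤l (≤-trans (s≤s z≤n) corner))

≽-remove : ∀ {ρ b z l} → ρ ≽ (suc z ∷ b) → InR ρ (b ∷ʳ suc z) l → strip (decAt ρ l) ≽ (z ∷ b)
≽-remove {ρ} {b} {z} {l} ρ≽ inR@(1≤l , _ , corner , dom) = record
  { positive  = strip-positive (decAt ρ l) (Decrement.antitone (decAt-Decrement ρ l 1≤l pos) antitone corner)
  ; antitone  = Decrement.antitone (InR-Decrement {ρ} {b ∷ʳ suc z} inR) antitone corner
  ; size      = sizes
  ; dominates = λ j → ≤-trans (≤-reflexive (sym (psum-sort-tilde b z j)))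
      (⊵-elim {strip (decAt ρ l)} {sortDesc (tilde (b ∷ʳ suc z))}
        (≤-reflexive (trans (sum-sort-tilde b z) (sym sizes))) dom j)
  }
  where
  open _≽_ ρ≽
  pos : 1 ≤ get ρ l
  pos = ≤-trans (s≤s z≤n) corner
  sizes : sum (strip (decAt ρ l)) ≡ z + sum b
  sizes = suc-injective (begin
    suc (sum (strip (decAt ρ l)))  ≡⟨ cong suc (sum-strip (decAt ρ l)) ⟩
    suc (sum (decAt ρ l))          ≡⟨ sum-decAt ρ l 1≤l pos ⟩
    sum ρ                          ≡⟨ size ⟩
    suc (z + sum b)                ∎)
    where open ≡-Reasoning

-- Existence of a removable row

last-row-≥ : ∀ (f : ℕ → ℕ) y k {i} → y ≤ f i → f (k + i) < y → ∃[ s ] (i ≤ s × y ≤ f s × f (suc s) < y)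
last-row-≥ f y zero    {i} y≤ <y = contradiction (≤-trans <y y≤) (<-irrefl refl)
last-row-≥ f y (suc k) {i} y≤ <y with y ≤? f (suc i)
... | no  y≰ = i , ≤-refl , y≤ , ≰⇒> y≰
... | yes y≤′ with last-row-≥ f y k y≤′ (subst (λ m → f m < y) (sym (+-suc k i)) <y)
...   | s , i<s , rest = s , <⇒≤ i<s , rest

-- If some best choice of `j` entries uses `z`, raising `z` raises the sum. Otherwise a best choice
-- avoids it, and the raised part can be added as one more entry.
top-gap : ∀ z b j → top (z ∷ b) j < top (suc z ∷ b) j ⊎ suc z + top (z ∷ b) j ≤ top (suc z ∷ b) (suc j)
top-gap z b zero    = inj₂ (top-pick (suc z) b zero)
top-gap z b (suc j) with ≤-total (top b (suc j)) (z + top b j)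
... | inj₁ le = inj₁ (≤-trans (s≤s (⊔-lub le ≤-refl)) (top-pick (suc z) b j))
... | inj₂ ge = inj₂ (≤-trans (+-monoʳ-≤ (suc z) (⊔-lub ≤-refl ge)) (top-pick (suc z) b (suc j)))

-- In the second case of `top-gap`, dominance at `suc j` has `suc z` to spare, whereas row `suc j`
-- lies after row `s` and contributes at most `z`; this makes dominance at `j` strict.
last-row-removable : ∀ {ρ b z s} → ρ ≽ (suc z ∷ b) → 1 ≤ s → suc z ≤ get ρ s → get ρ (suc s) < suc z →
  Removable (get ρ) (z ∷ b) s
last-row-removable {ρ} {b} {z} {s} ρ≽ 1≤s z<ρs ρs+1≤z = 1≤s , ≤-trans ρs+1≤z z<ρs , dom
  where
  open _≽_ ρ≽
  dom : ∀ j → s ≤ j → top (z ∷ b) j < psum (get ρ) j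
  dom j s≤j with top-gap z b j
  ... | inj₁ lt = ≤-trans lt (dominates j)
  ... | inj₂ le = +-cancelˡ-≤ z _ _ (begin
    z + suc (top (z ∷ b) j)             ≡⟨ +-suc z _ ⟩
    suc z + top (z ∷ b) j               ≤⟨ le ⟩
    top (suc z ∷ b) (suc j)             ≤⟨ dominates (suc j) ⟩
    psum (get ρ) j + get ρ (suc j)      ≤⟨ +-monoʳ-≤ _ (antitone-≤ antitone (s≤s z≤n) (s≤s s≤j)) ⟩
    psum (get ρ) j + get ρ (suc s)      ≤⟨ +-monoʳ-≤ _ (s≤s⁻¹ ρs+1≤z) ⟩
    psum (get ρ) j + z                  ≡⟨ +-comm _ z ⟩
    z + psum (get ρ) j                  ∎)
    where open ≤-Reasoning

-- The least element found by bounded search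

does-true : ∀ {A : Set} (d : Dec A) → does d ≡ true → A
does-true (yes x) _ = x

true-does : ∀ {A : Set} (d : Dec A) → A → does d ≡ true
true-does (yes _) _ = refl
true-does (no ¬x) x = contradiction x ¬x

firstFrom-least : ∀ p s k {m} → s ≤ m → m < s + k → p m ≡ true →
  ∃[ l ] (firstFrom p s k ≡ just l × p l ≡ true × s ≤ l × l ≤ m × (∀ x → s ≤ x → x < l → p x ≡ false))
firstFrom-least p s zero {m} s≤m m<s _ = contradiction (≤-trans m<s (≤-trans (≤-reflexive (+-identityʳ s)) s≤m)) (<-irrefl refl)
firstFrom-least p s (suc k) {m} s≤m m<s+k pm with p s in ps
... | true  = s , refl , ps , ≤-refl , s≤m , λ x s≤x x<s → contradiction (≤-trans x<s s≤x) (<-irrefl refl)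
... | false with m≤n⇒m<n∨m≡n s≤m
...   | inj₂ refl = contradiction (trans (sym ps) pm) λ ()
...   | inj₁ s<m with firstFrom-least p (suc s) k s<m (subst (m <_) (+-suc s k) m<s+k) pm
...     | l , eq , pl , s<l , l≤m , least = l , eq , pl , <⇒≤ s<l , l≤m , least′
  where
  least′ : ∀ x → s ≤ x → x < l → p x ≡ false
  least′ x s≤x x<l with m≤n⇒m<n∨m≡n s≤x
  ... | inj₁ s<x  = least x s<x x<l
  ... | inj₂ refl = ps

lmin-least : ∀ ρ a i {m} → i ≤ m → InR ρ a m →
  InR ρ a (lmin ρ a i) × i ≤ lmin ρ a i × lmin ρ a i ≤ m × (∀ x → i ≤ x → x < lmin ρ a i → ¬ InR ρ a x)
lmin-least ρ a i {m} i≤m inR@(_ , m≤len , _)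
  with firstFrom (λ r → does (InR? ρ a r)) i (suc (length ρ) ∸ i)
     | firstFrom-least (λ r → does (InR? ρ a r)) i (suc (length ρ) ∸ i) i≤m
         (≤-trans (s≤s m≤len) (m≤n+m∸n (suc (length ρ)) i)) (true-does (InR? ρ a m) inR)
... | .(just l) | l , refl , pl , i≤l , l≤m , least =
  does-true (InR? ρ a l) pl , i≤l , l≤m ,
  λ x i≤x x<l xR → contradiction (trans (sym (true-does (InR? ρ a x) xR)) (least x i≤x x<l)) λ ()

-- The last row of length at least `suc z` is removable and lies at or after `i`, so the search
-- succeeds no later than there. The row found is therefore also at least `suc z` long.
lmin-step : ∀ {ρ b z i} → ρ ≽ (suc z ∷ b) → 1 ≤ i → suc z ≤ get ρ i →
  let l = lmin ρ (b ∷ʳ suc z) i in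
  InR ρ (b ∷ʳ suc z) l × i ≤ l × suc z ≤ get ρ l × (∀ x → i ≤ x → x < l → ¬ Removable (get ρ) (z ∷ b) x)
lmin-step {ρ} {b} {z} {i} ρ≽ 1≤i z<ρi
  with last-row-≥ (get ρ) (suc z) (suc (length ρ)) z<ρi
         -- A row past the end of the partition is empty, which bounds the search for the last long
         -- row.
         (subst (_< suc z) (sym (get-beyond ρ (suc (length ρ) + i) (m≤m+n _ i))) (s≤s z≤n))
... | s , i≤s , z<ρs , ρs+1≤z
  with lmin-least ρ (b ∷ʳ suc z) i i≤s
         (removable⇒InR ρ≽ (last-row-removable ρ≽ (≤-trans 1≤i i≤s) z<ρs ρs+1≤z))
...   | inR , i≤l , l≤s , least =
  inR , i≤l , ≤-trans z<ρs (antitone-≤ (_≽_.antitone ρ≽) (≤-trans 1≤i i≤l) l≤s) ,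
  λ x i≤x x<l rem → least x i≤x x<l (removable⇒InR ρ≽ rem)

-- Comparison of the greedy removal with another horizontal strip

-- `f` is the current greedy shape, `g` the shape that the other tableau has once the letter is
-- gone, and `l` the row from which the next search starts. Rows after `l` have not been touched
-- yet, so they still contain those of `g`.
record Ahead (f : ℕ → ℕ) (l : ℕ) (g : ℕ → ℕ) : Set where
  field
    below  : ∀ j → j < l → psum f j ≤ psum g j
    beyond : ∀ i → l < i → g i ≤ f i
    nested : ∀ i → 1 ≤ i → f (suc i) ≤ g i

psum-<-extend : ∀ f g {i j} → (∀ k → i < k → g k ≤ f k) → i ≤ j → psum g i < psum f i → psum g j < psum f j
psum-<-extend f g {i} {j} g≤f i≤j lt with m≤n⇒m<n∨m≡n i≤j
... | inj₂ refl = lt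
psum-<-extend f g {i} {suc j} g≤f i≤j lt | inj₁ (s≤s i≤j′) =
  +-mono-<-≤ (psum-<-extend f g g≤f i≤j′ lt) (g≤f (suc j) (s≤s i≤j′))

-- The first row up to which g would have removed more cells than f is itself
-- removable, so the greedy choice l′ cannot lie beyond it.
ahead-below : ∀ {ρ b z l l′ g} → ρ ≽ (suc z ∷ b) → (∀ j → top b j ≤ psum g j) → Ahead (get ρ) l g →
  (∀ x → l ≤ x → x < l′ → ¬ Removable (get ρ) (z ∷ b) x) → ∀ j → j < l′ → psum (get ρ) j ≤ psum g j
ahead-below ρ≽ g-dom A least zero j<l′ = z≤n
ahead-below {ρ} {b} {z} {l} {l′} {g} ρ≽ g-dom A least (suc j) j<l′
  with suc j <? l | psum (get ρ) (suc j) ≤? psum g (suc j)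
... | yes j<l | _      = Ahead.below A (suc j) j<l
... | no _    | yes le = le
... | no j≮l  | no  ¬le = contradiction (s≤s z≤n , corner , dom) (least (suc j) (≮⇒≥ j≮l) j<l′)
  where
  open ≤-Reasoning
  f = get ρ
  lt : psum g (suc j) < psum f (suc j)
  lt = ≰⇒> ¬le
  ih : psum f j ≤ psum g j
  ih = ahead-below ρ≽ g-dom A least j (<-trans (n<1+n j) j<l′)
  corner : f (suc (suc j)) < f (suc j)
  -- At the first failure row `suc j` of `f` must exceed that of `g`, and the horizontal strip
  -- condition puts the next row of `f` below that of `g`.
  corner = ≤-trans (s≤s (Ahead.nested A (suc j) (s≤s z≤n))) (+-cancelˡ-< (psum f j) _ _ (begin-strict
    psum f j + g (suc j)  ≤⟨ +-monoˡ-≤ _ ih ⟩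
    psum g j + g (suc j)  <⟨ lt ⟩
    psum f j + f (suc j)  ∎))
  dom : ∀ i → suc j ≤ i → top (z ∷ b) i < psum f i
  -- Choices that omit `z` are bounded by `g`, whose deficit persists in later rows. Choices that
  -- use `z` gain one when it is raised to `suc z`, and `f` dominates the raised weight.
  dom (suc i) j≤i = ⊔-pres-<m
    (≤-trans (s≤s (g-dom (suc i)))
      (psum-<-extend f g (λ k j<k → Ahead.beyond A k (≤-trans (s≤s (≮⇒≥ j≮l)) j<k)) j≤i lt))
    (≤-trans (top-pick (suc z) b i) (_≽_.dominates ρ≽ (suc i)))

ahead-step : ∀ {ρ b z l l′ g f′} → ρ ≽ (suc z ∷ b) → (∀ j → top b j ≤ psum g j) → Ahead (get ρ) l g → l ≤ l′ →
  (∀ x → l ≤ x → x < l′ → ¬ Removable (get ρ) (z ∷ b) x) → Decrement (get ρ) l′ f′ → Ahead f′ l′ g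
ahead-step {ρ} {l′ = l′} {g} {f′} ρ≽ g-dom A l≤l′ least d = record
  { below  = λ j j<l′ → ≤-trans (≤-reflexive (D.below j j<l′)) (ahead-below ρ≽ g-dom A least j j<l′)
  ; beyond = λ i l′<i → ≤-trans (Ahead.beyond A i (≤-<-trans l≤l′ l′<i))
               (≤-reflexive (sym (D.off i λ eq → <⇒≢ l′<i (sym eq))))
  ; nested = λ i 1≤i → ≤-trans (D.≤-pointwise (suc i)) (Ahead.nested A i 1≤i)
  } where module D = Decrement d

-- From row `l` on, a deficit of `g` could never be made up, since its later rows are no longer than
-- those of `f`. It would persist to `L`, where the totals agree.
ahead-final : ∀ {f g l} L → Ahead f l g → (∀ j → L ≤ j → psum f j ≡ psum g j) →
  ∀ j → psum f j ≤ psum g j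
ahead-final {f} {g} {l} L A eq j with j <? l | j ≤? L
... | yes j<l | _ = Ahead.below A j j<l
... | no _    | no j≰L = ≤-reflexive (eq j (<⇒≤ (≰⇒> j≰L)))
... | no j≮l  | yes j≤L = ≮⇒≥ λ lt → <-irrefl (sym (eq L ≤-refl))
  (psum-<-extend f g (λ k j<k → Ahead.beyond A k (≤-<-trans (≮⇒≥ j≮l) j<k)) j≤L lt)

-- Prefix and suffix sums of the weight

take-suc-get : ∀ xs {p} → p < length xs → take (suc p) xs ≡ take p xs ∷ʳ get xs (suc p)
take-suc-get (x ∷ xs) {zero}  _        = refl
take-suc-get (x ∷ xs) {suc p} (s≤s lt) = cong (x ∷_) (take-suc-get xs lt)

sum-drop-suc : ∀ xs {p} → p < length xs → get xs (suc p) + sum (drop (suc p) xs) ≡ sum (drop p xs)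
sum-drop-suc (x ∷ xs) {zero}  _        = refl
sum-drop-suc (x ∷ xs) {suc p} (s≤s lt) = sum-drop-suc xs lt

sum-take-drop : ∀ xs p → sum (take p xs) + sum (drop p xs) ≡ sum xs
sum-take-drop xs p = trans (sym (sum-++ (take p xs) (drop p xs))) (cong sum (take++drop≡id p xs))

sum-drop-antitone : ∀ xs {p q} → p ≤ q → sum (drop q xs) ≤ sum (drop p xs)
sum-drop-antitone []       {zero}  {zero}  _         = ≤-refl
sum-drop-antitone []       {zero}  {suc q} _         = ≤-refl
sum-drop-antitone []       {suc p} {suc q} _         = ≤-refl
sum-drop-antitone (x ∷ xs) {zero}  {zero}  _         = ≤-refl
sum-drop-antitone (x ∷ xs) {zero}  {suc q} _         = ≤-trans (sum-drop-antitone xs {zero} {q} z≤n) (m≤n+m _ x)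
sum-drop-antitone (x ∷ xs) {suc p} {suc q} (s≤s p≤q) = sum-drop-antitone xs p≤q

drop-length : ∀ (xs : List ℕ) → drop (length xs) xs ≡ []
drop-length []       = refl
drop-length (x ∷ xs) = drop-length xs

-- Letters are removed from the last one down. At time `i` the letter being removed is `suc p`, and
-- `k` of its copies are already gone.
suffix-position : ∀ xs {i} → i < sum xs →
  ∃[ p ] ∃[ k ] (p < length xs × k < get xs (suc p) × i ≡ k + sum (drop (suc p) xs))
suffix-position (x ∷ xs) {i} i<sum with i <? sum xs
... | yes lt with suffix-position xs lt
...   | p , k , p<len , k<x , eq = suc p , k , s≤s p<len , k<x , eq
suffix-position (x ∷ xs) {i} i<sum | no ge =
  0 , i ∸ sum xs , s≤s z≤n ,
  +-cancelʳ-< (sum xs) _ _ (subst (_< x + sum xs) (sym (m∸n+n≡m (≮⇒≥ ge))) i<sum) , sym (m∸n+n≡m (≮⇒≥ ge))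

take-length-++ : ∀ (xs ys : List ℕ) → take (length xs) (xs ++ ys) ≡ xs
take-length-++ []       ys = refl
take-length-++ (x ∷ xs) ys = cong (x ∷_) (take-length-++ xs ys)

sum-take-reverse : ∀ xs q → sum (take (length xs ∸ q) (reverse xs)) ≡ sum (drop q xs)
sum-take-reverse xs q = begin
  sum (take (length xs ∸ q) (reverse xs))                       ≡⟨ cong (λ ys → sum (take (length xs ∸ q) (reverse ys))) (take++drop≡id q xs) ⟨
  sum (take (length xs ∸ q) (reverse (take q xs ++ drop q xs))) ≡⟨ cong₂ (λ m ys → sum (take m ys)) len (reverse-++ (take q xs) (drop q xs)) ⟩
  sum (take (length rd) (rd ++ reverse (take q xs)))            ≡⟨ cong sum (take-length-++ rd _) ⟩
  sum rd                                                        ≡⟨ sum-↭ (↭-reverse (drop q xs)) ⟩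
  sum (drop q xs)                                               ∎
  where
  open ≡-Reasoning
  rd = reverse (drop q xs)
  len : length xs ∸ q ≡ length rd
  len = sym (trans (length-reverse (drop q xs)) (length-drop q xs))

∷ʳ⁺-pos : ∀ b {y} → 1 ≤ y → b ∷ʳ⁺ y ≡ b ∷ʳ y
∷ʳ⁺-pos b {suc y} _ = refl

-- The set A

any-true : ∀ {A : Set} (p : A → Bool) {x xs} → x ∈ xs → p x ≡ true → any p xs ≡ true
any-true p (here refl) px rewrite px = refl
any-true p {xs = y ∷ _} (there x∈) px rewrite any-true p x∈ px = ∨-zeroʳ (p y)

any-false : ∀ {A : Set} (p : A → Bool) xs → (∀ {x} → x ∈ xs → p x ≡ false) → any p xs ≡ false
any-false p []       none = refl
any-false p (x ∷ xs) none rewrite none (here refl) = any-false p xs λ x∈ → none (there x∈)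

≡ᵇ-true : ∀ {m n} → m ≡ n → (m ≡ᵇ n) ≡ true
≡ᵇ-true {m} {n} eq = Equivalence.to T-≡ (≡⇒≡ᵇ m n eq)

≡ᵇ-false : ∀ {m n} → m ≢ n → (m ≡ᵇ n) ≡ false
≡ᵇ-false {m} {n} m≢n with m ≡ᵇ n in eq
... | false = refl
... | true  = contradiction (≡ᵇ⇒≡ m n (Equivalence.from T-≡ eq)) m≢n

inA-true : ∀ a {p} → 1 ≤ p → p < length a → inA a (sum (drop p a)) ≡ true
inA-true a {suc p} _ p<len = any-true _
  (∈-map⁺ suc (∈-upTo⁺ {length a ∸ 1} {length a ∸ suc (suc p)} (∸-monoʳ-< (s≤s (s≤s z≤n)) p<len)))
  (≡ᵇ-true (trans (sym (sum-take-reverse a (suc p))) (cong (λ m → sum (take m (reverse a))) eq)))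
  where
  eq : length a ∸ suc p ≡ suc (length a ∸ suc (suc p))
  eq = +-∸-assoc 1 p<len

-- Membership would make this time a suffix sum from some `q < length a`. For `q ≤ p` that sum is
-- too large; for `q > p` it is too small when `1 ≤ k`, and there is no such `q` when the letter is
-- the last one.
inA-false : ∀ a {p k} → p < length a → k < get a (suc p) → 1 ≤ k ⊎ suc p ≡ length a →
  inA a (k + sum (drop (suc p) a)) ≡ false
inA-false a {p} {k} p<len k<a inside = any-false _ (range1 (length a ∸ 1)) none
  where
  none : ∀ {m} → m ∈ range1 (length a ∸ 1) → (k + sum (drop (suc p) a) ≡ᵇ sum (take m (reverse a))) ≡ false
  none m∈ with ∈-map⁻ suc m∈
  ... | m′ , m′∈ , refl = ≡ᵇ-false λ eq → absurd inside (trans eq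
      (trans (cong (λ m → sum (take m (reverse a))) (sym (m∸[m∸n]≡n m≤len))) (sum-take-reverse a q)))
    where
    open ≤-Reasoning
    q = length a ∸ suc m′
    m≤len : suc m′ ≤ length a
    m≤len = ≤-trans (∈-upTo⁻ m′∈) (m∸n≤m (length a) 1)
    q<len : q < length a
    q<len = ∸-monoʳ-< {length a} {suc m′} {0} (s≤s z≤n) m≤len
    absurd : 1 ≤ k ⊎ suc p ≡ length a → k + sum (drop (suc p) a) ≢ sum (drop q a)
    absurd inside′ eq with q ≤? p | inside′
    ... | yes q≤p | _ = <-irrefl eq (begin-strict
      k + sum (drop (suc p) a)              <⟨ +-monoˡ-< _ k<a ⟩
      get a (suc p) + sum (drop (suc p) a)  ≡⟨ sum-drop-suc a p<len ⟩
      sum (drop p a)                        ≤⟨ sum-drop-antitone a q≤p ⟩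
      sum (drop q a)                        ∎)
    ... | no q≰p | inj₁ 1≤k = <-irrefl (sym eq) (begin-strict
      sum (drop q a)            ≤⟨ sum-drop-antitone a (≰⇒> q≰p) ⟩
      sum (drop (suc p) a)      <⟨ m<n+m _ 1≤k ⟩
      k + sum (drop (suc p) a)  ∎)
    ... | no q≰p | inj₂ last = <-irrefl refl (≤-trans q<len (≤-trans (≤-reflexive (sym last)) (≰⇒> q≰p)))

-- The bound s(μ,a)

lastUpTo-spec : ∀ p k {r} → 1 ≤ r → r ≤ lastUpTo p k → p (lastUpTo p k) ≡ true
lastUpTo-spec p zero    1≤r r≤ = contradiction (≤-trans 1≤r r≤) λ ()
lastUpTo-spec p (suc k) 1≤r r≤ with p (suc k) in eq
... | true  = eq
... | false = lastUpTo-spec p k 1≤r r≤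

-- As `1 ≤ r`, the search behind `sIdx` did not end in its default 0. So row `sIdx μ a` is at least
-- as long as the last part, and row `r` is no shorter than that row.
sIdx-spec : ∀ {μ} a {r} → Antitone (get μ) → 1 ≤ r → r ≤ sIdx μ a → lastE a ≤ get μ r
sIdx-spec {μ} a anti 1≤r r≤s = ≤-trans
  (≤ᵇ⇒≤ _ _ (Equivalence.from T-≡ (lastUpTo-spec (λ i → lastE a ≤ᵇ get μ i) (length μ) 1≤r r≤s)))
  (antitone-≤ anti 1≤r r≤s)

-- Counting cells

range1-∷ʳ : ∀ m → range1 (suc m) ≡ range1 m ∷ʳ suc m
range1-∷ʳ m = trans (cong (map suc) (sym (upTo-∷ʳ m))) (map-++ suc (upTo m) (m ∷ []))

count : {P : ℕ → Set} → (∀ j → Dec (P j)) → ℕ → ℕ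
count P? m = length (filter P? (range1 m))

module _ {P : ℕ → Set} (P? : ∀ j → Dec (P j)) where

  count-∷ʳ : ∀ m → count P? (suc m) ≡ count P? m + length (filter P? (suc m ∷ []))
  count-∷ʳ m = begin
    length (filter P? (range1 (suc m)))                      ≡⟨ cong (λ js → length (filter P? js)) (range1-∷ʳ m) ⟩
    length (filter P? (range1 m ∷ʳ suc m))                   ≡⟨ cong length (filter-++ P? (range1 m) _) ⟩
    length (filter P? (range1 m) ++ filter P? (suc m ∷ []))  ≡⟨ length-++ (filter P? (range1 m)) ⟩
    count P? m + length (filter P? (suc m ∷ []))             ∎
    where open ≡-Reasoning

  count-yes : ∀ {m} → P (suc m) → count P? (suc m) ≡ suc (count P? m)
  count-yes {m} p = trans (count-∷ʳ m)
    (trans (cong (λ js → count P? m + length js) (filter-accept P? {xs = []} p)) (+-comm _ 1))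

  count-no : ∀ {m} → ¬ P (suc m) → count P? (suc m) ≡ count P? m
  count-no {m} ¬p = trans (count-∷ʳ m)
    (trans (cong (λ js → count P? m + length js) (filter-reject P? {xs = []} ¬p)) (+-identityʳ _))

  count≤ : ∀ m → count P? m ≤ m
  count≤ zero    = z≤n
  count≤ (suc m) with P? (suc m)
  ... | yes p = ≤-trans (≤-reflexive (count-yes p)) (s≤s (count≤ m))
  ... | no ¬p = ≤-trans (≤-reflexive (count-no ¬p)) (m≤n⇒m≤1+n (count≤ m))

  count-all : ∀ m → (∀ j → 1 ≤ j → j ≤ m → P j) → count P? m ≡ m
  count-all zero    all = refl
  count-all (suc m) all = trans (count-yes (all (suc m) (s≤s z≤n) ≤-refl))
    (cong suc (count-all m λ j 1≤j j≤m → all j 1≤j (m≤n⇒m≤1+n j≤m)))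

  DownClosed : ℕ → Set
  DownClosed m = ∀ j → 1 ≤ j → suc j ≤ m → P (suc j) → P j

  down-all : ∀ m → DownClosed m → P m → ∀ j → 1 ≤ j → j ≤ m → P j
  down-all m down Pm j 1≤j j≤m with m≤n⇒m<n∨m≡n j≤m
  ... | inj₂ refl = Pm
  down-all (suc m) down Pm j 1≤j j≤m | inj₁ (s≤s j≤m′) =
    down-all m (λ i 1≤i i<m → down i 1≤i (m≤n⇒m≤1+n i<m)) (down m (≤-trans 1≤j j≤m′) ≤-refl Pm) j 1≤j j≤m′

  -- A down-closed set of columns is an initial segment, so its size determines it. In a weakly
  -- increasing row the entries at most `q` form such a set.
  count-down : ∀ m → DownClosed m → ∀ j → 1 ≤ j → j ≤ m → P j ⇔ j ≤ count P? m
  count-down zero    down j 1≤j j≤m = contradiction (≤-trans 1≤j j≤m) λ ()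
  count-down (suc m) down j 1≤j j≤m with P? (suc m)
  ... | yes p = mk⇔
    (λ _ → ≤-trans j≤m (≤-reflexive (sym (count-all (suc m) (down-all (suc m) down p)))))
    (λ _ → down-all (suc m) down p j 1≤j j≤m)
  ... | no ¬p with m≤n⇒m<n∨m≡n j≤m
  ...   | inj₂ refl = mk⇔ (λ p → contradiction p ¬p)
    (λ le → contradiction (≤-trans le (≤-trans (≤-reflexive (count-no ¬p)) (count≤ m))) (<-irrefl refl))
  ...   | inj₁ (s≤s j≤m′) = mk⇔
    (λ p → ≤-trans (Equivalence.to ih p) (≤-reflexive (sym (count-no ¬p))))
    (λ le → Equivalence.from ih (≤-trans le (≤-reflexive (count-no ¬p))))
    where ih = count-down m (λ i 1≤i i<m → down i 1≤i (m≤n⇒m≤1+n i<m)) j 1≤j j≤m′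

  -- The specification itself makes `P` down-closed, so `count-down` applies and two initial
  -- segments are compared.
  count-unique : ∀ m {c} → c ≤ m → (∀ j → 1 ≤ j → j ≤ m → P j ⇔ j ≤ c) → count P? m ≡ c
  count-unique m {c} c≤m spec = ≤-antisym (below (count P? m) (count≤ m) refl) (above c c≤m refl)
    where
    cd = count-down m λ j 1≤j j<m p →
      Equivalence.from (spec j 1≤j (<⇒≤ j<m)) (<⇒≤ (Equivalence.to (spec (suc j) (s≤s z≤n) j<m) p))
    below : ∀ k → k ≤ m → k ≡ count P? m → k ≤ c
    below zero    _   _  = z≤n
    below (suc k) k≤m eq = Equivalence.to (spec (suc k) (s≤s z≤n) k≤m)
      (Equivalence.from (cd (suc k) (s≤s z≤n) k≤m) (≤-reflexive eq))
    above : ∀ k → k ≤ m → k ≡ c → k ≤ count P? m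
    above zero    _   _  = z≤n
    above (suc k) k≤m eq = Equivalence.to (cd (suc k) (s≤s z≤n) k≤m)
      (Equivalence.from (spec (suc k) (s≤s z≤n) k≤m) (≤-reflexive eq))

count-≤-suc : ∀ (t : ℕ → ℕ) q m →
  count (λ j → t j ≤? suc q) m ≡ count (λ j → t j ≤? q) m + count (λ j → t j ≟ suc q) m
count-≤-suc t q zero    = refl
count-≤-suc t q (suc m) = begin
  count (λ j → t j ≤? suc q) (suc m)   ≡⟨ count-∷ʳ (λ j → t j ≤? suc q) m ⟩
  count (λ j → t j ≤? suc q) m + length (filter (λ j → t j ≤? suc q) (suc m ∷ []))
    ≡⟨ cong₂ _+_ (count-≤-suc t q m) single ⟩
  (A + B) + (C + D)                    ≡⟨ interchange +-commutativeSemigroup A B C D ⟩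
  (A + C) + (B + D)                    ≡⟨ cong₂ _+_ (count-∷ʳ (λ j → t j ≤? q) m) (count-∷ʳ (λ j → t j ≟ suc q) m) ⟨
  count (λ j → t j ≤? q) (suc m) + count (λ j → t j ≟ suc q) (suc m) ∎
  where
  open ≡-Reasoning
  A = count (λ j → t j ≤? q) m
  B = count (λ j → t j ≟ suc q) m
  C = length (filter (λ j → t j ≤? q) (suc m ∷ []))
  D = length (filter (λ j → t j ≟ suc q) (suc m ∷ []))
  accept : ∀ {P : ℕ → Set} (P? : ∀ j → Dec (P j)) → P (suc m) → length (filter P? (suc m ∷ [])) ≡ 1
  accept P? p = cong length (filter-accept P? {xs = []} p)
  reject : ∀ {P : ℕ → Set} (P? : ∀ j → Dec (P j)) → ¬ P (suc m) → length (filter P? (suc m ∷ [])) ≡ 0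
  reject P? ¬p = cong length (filter-reject P? {xs = []} ¬p)
  single : length (filter (λ j → t j ≤? suc q) (suc m ∷ [])) ≡ C + D
  single = split (t (suc m) ≤? q) (t (suc m) ≟ suc q)
    where
    split : Dec (t (suc m) ≤ q) → Dec (t (suc m) ≡ suc q) →
      length (filter (λ j → t j ≤? suc q) (suc m ∷ [])) ≡ C + D
    split (yes le) (yes eq) = contradiction (≤-trans (≤-reflexive (sym eq)) le) (<-irrefl refl)
    split (yes le) (no ≢)   = trans (accept (λ j → t j ≤? suc q) (m≤n⇒m≤1+n le)) (sym (cong₂ _+_ (accept (λ j → t j ≤? q) le) (reject (λ j → t j ≟ suc q) ≢)))
    split (no ≰)   (yes eq) = trans (accept (λ j → t j ≤? suc q) (≤-reflexive eq)) (sym (cong₂ _+_ (reject (λ j → t j ≤? q) ≰) (accept (λ j → t j ≟ suc q) eq)))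
    split (no ≰)   (no ≢)   = trans (reject (λ j → t j ≤? suc q) λ le → ≢ (≤-antisym le (≰⇒> ≰)))
      (sym (cong₂ _+_ (reject (λ j → t j ≤? q) ≰) (reject (λ j → t j ≟ suc q) ≢)))

psum-+ : ∀ f g j → psum (λ i → f i + g i) j ≡ psum f j + psum g j
psum-+ f g zero    = refl
psum-+ f g (suc j) = begin
  psum (λ i → f i + g i) j + (x + y)  ≡⟨ cong (_+ (x + y)) (psum-+ f g j) ⟩
  (F + G) + (x + y)                   ≡⟨ interchange +-commutativeSemigroup F G x y ⟩
  (F + x) + (G + y)                   ∎
  where
  open ≡-Reasoning
  F = psum f j
  G = psum g j
  x = f (suc j)
  y = g (suc j)

length-filter-map : ∀ {A B : Set} {P : B → Set} (P? : ∀ b → Dec (P b)) (f : A → B) xs →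
  length (filter P? (map f xs)) ≡ length (filter (λ x → P? (f x)) xs)
length-filter-map P? f []       = refl
length-filter-map P? f (x ∷ xs) with does (P? (f x))
... | true  = cong suc (length-filter-map P? f xs)
... | false = length-filter-map P? f xs

count-cells : ∀ {P : ℕ × ℕ → Set} (P? : ∀ c → Dec (P c)) (g : ℕ → ℕ) m →
  length (filter P? (concatMap (λ i → map (λ j → i , j) (range1 (g i))) (range1 m)))
    ≡ psum (λ i → count (λ j → P? (i , j)) (g i)) m
count-cells P? g zero    = refl
count-cells P? g (suc m) = begin
  length (filter P? (concatMap row (range1 (suc m))))
    ≡⟨ cong (λ is → length (filter P? (concatMap row is))) (range1-∷ʳ m) ⟩
  length (filter P? (concatMap row (range1 m ∷ʳ suc m)))
    ≡⟨ cong (λ cs → length (filter P? cs)) (concatMap-++ row (range1 m) (suc m ∷ [])) ⟩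
  length (filter P? (concatMap row (range1 m) ++ (row (suc m) ++ [])))
    ≡⟨ cong (λ cs → length (filter P? (concatMap row (range1 m) ++ cs))) (++-identityʳ (row (suc m))) ⟩
  length (filter P? (concatMap row (range1 m) ++ row (suc m)))
    ≡⟨ cong length (filter-++ P? (concatMap row (range1 m)) _) ⟩
  length (filter P? (concatMap row (range1 m)) ++ filter P? (row (suc m)))
    ≡⟨ length-++ (filter P? (concatMap row (range1 m))) ⟩
  length (filter P? (concatMap row (range1 m))) + length (filter P? (row (suc m)))
    ≡⟨ cong₂ _+_ (count-cells P? g m) (length-filter-map P? (λ j → suc m , j) (range1 (g (suc m)))) ⟩
  psum (λ i → count (λ j → P? (i , j)) (g i)) (suc m) ∎
  where
  open ≡-Reasoning
  row : ℕ → List (ℕ × ℕ)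
  row i = map (λ j → i , j) (range1 (g i))

sum-map-range1 : ∀ f m → sum (map f (range1 m)) ≡ psum f m
sum-map-range1 f zero    = refl
sum-map-range1 f (suc m) = begin
  sum (map f (range1 (suc m)))       ≡⟨ cong (λ is → sum (map f is)) (range1-∷ʳ m) ⟩
  sum (map f (range1 m ∷ʳ suc m))    ≡⟨ cong sum (map-++ f (range1 m) (suc m ∷ [])) ⟩
  sum (map f (range1 m) ∷ʳ f (suc m)) ≡⟨ sum-∷ʳ (map f (range1 m)) (f (suc m)) ⟩
  f (suc m) + sum (map f (range1 m)) ≡⟨ +-comm (f (suc m)) _ ⟩
  sum (map f (range1 m)) + f (suc m) ≡⟨ cong (_+ f (suc m)) (sum-map-range1 f m) ⟩
  psum f (suc m)                     ∎
  where open ≡-Reasoning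

get-applyUpTo : ∀ f m i → i < m → get (applyUpTo f m) (suc i) ≡ f i
get-applyUpTo f (suc m) zero    _         = refl
get-applyUpTo f (suc m) (suc i) (s≤s i<m) = get-applyUpTo (λ k → f (suc k)) m i i<m

get-map-range1 : ∀ f m i → 1 ≤ i → i ≤ m → get (map f (range1 m)) i ≡ f i
get-map-range1 f m (suc i) _ i<m = trans
  (cong (λ xs → get xs (suc i)) (trans (sym (map-∘ (upTo m))) (map-upTo (λ k → f (suc k)) m)))
  (get-applyUpTo (λ k → f (suc k)) m i i<m)

length-map-range1 : ∀ (f : ℕ → ℕ) m → length (map f (range1 m)) ≡ m
length-map-range1 f m = trans (length-map f (range1 m)) (trans (length-map suc (upTo m)) (length-upTo m))

-- Row lengths of the entries at most q

rowCount : List ℕ → Tableau → ℕ → ℕ → ℕ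
rowCount μ T q i = count (λ j → T i j ≤? q) (get μ i)

rowCount≤ : ∀ μ T q i → rowCount μ T q i ≤ get μ i
rowCount≤ μ T q i = count≤ (λ j → T i j ≤? q) (get μ i)

rowCount-beyond : ∀ μ T q {i} → length μ < i → rowCount μ T q i ≡ 0
rowCount-beyond μ T q {i} len<i = n≤0⇒n≡0 (≤-trans (rowCount≤ μ T q i) (≤-reflexive (get-beyond μ i len<i)))

get-rowCounts : ∀ μ T q i → 1 ≤ i → get (map (rowCount μ T q) (range1 (length μ))) i ≡ rowCount μ T q i
get-rowCounts μ T q i 1≤i with i ≤? length μ
... | yes i≤len = get-map-range1 (rowCount μ T q) (length μ) i 1≤i i≤len
... | no  i≰len = trans
  (get-beyond (map (rowCount μ T q) (range1 (length μ))) i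
    (≤-trans (s≤s (≤-reflexive (length-map-range1 (rowCount μ T q) (length μ)))) (≰⇒> i≰len)))
  (sym (rowCount-beyond μ T q (≰⇒> i≰len)))

get-tau : ∀ μ T q i → 1 ≤ i → get (tau μ T q) i ≡ rowCount μ T q i
get-tau μ T q i 1≤i = trans (get-strip (map (rowCount μ T q) (range1 (length μ))) i) (get-rowCounts μ T q i 1≤i)

sum-tau : ∀ μ T q → sum (tau μ T q) ≡ psum (rowCount μ T q) (length μ)
sum-tau μ T q = trans (sum-strip (map (rowCount μ T q) (range1 (length μ))))
  (sum-map-range1 (rowCount μ T q) (length μ))

tau-positive : ∀ μ T q → Antitone (rowCount μ T q) → Positive (tau μ T q)
tau-positive μ T q anti = strip-positive (map (rowCount μ T q) (range1 (length μ))) λ i 1≤i →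
  subst₂ _≤_ (sym (get-rowCounts μ T q (suc i) (s≤s z≤n))) (sym (get-rowCounts μ T q i 1≤i)) (anti i 1≤i)

psum-vanish : ∀ f {L j} → (∀ i → L < i → f i ≡ 0) → L ≤ j → psum f j ≡ psum f L
psum-vanish f {L} {j} f≡0 L≤j with m≤n⇒m<n∨m≡n L≤j
... | inj₂ refl = refl
psum-vanish f {L} {suc j} f≡0 L≤j | inj₁ (s≤s L≤j′) = trans
  (cong₂ _+_ (psum-vanish f f≡0 L≤j′) (f≡0 (suc j) (s≤s L≤j′))) (+-identityʳ _)

countVal-suc : ∀ μ T q →
  psum (rowCount μ T (suc q)) (length μ) ≡ psum (rowCount μ T q) (length μ) + countVal μ T (suc q)
countVal-suc μ T q = begin
  psum (rowCount μ T (suc q)) (length μ)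
    ≡⟨ psum-cong (λ i _ → count-≤-suc (T i) q (get μ i)) (length μ) ⟩
  psum (λ i → rowCount μ T q i + count (λ j → T i j ≟ suc q) (get μ i)) (length μ)
    ≡⟨ psum-+ (rowCount μ T q) _ (length μ) ⟩
  psum (rowCount μ T q) (length μ) + psum (λ i → count (λ j → T i j ≟ suc q) (get μ i)) (length μ)
    ≡⟨ cong (psum (rowCount μ T q) (length μ) +_) (count-cells (λ c → T (proj₁ c) (proj₂ c) ≟ suc q) (get μ) (length μ)) ⟨
  psum (rowCount μ T q) (length μ) + countVal μ T (suc q) ∎
  where open ≡-Reasoning

-- A semistandard tableau as a chain of shapes

-- A choice that omits `x` is bounded by `g`, hence by `f`. For one that uses `x`: the rows of `f`
-- after the first `suc j` fit into the rows of `g` after the first `j`, so the first `suc j` rows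
-- of `f` hold at least `x + psum g j` cells.
interlacing-top : ∀ {f g b x L} → (∀ j → top b j ≤ psum g j) → (∀ i → 1 ≤ i → g i ≤ f i) →
  (∀ i → 1 ≤ i → f (suc i) ≤ g i) → (∀ j → L ≤ j → psum f j ≡ x + psum g j) → (∀ j → L ≤ j → g (suc j) ≡ 0) →
  ∀ j → top (x ∷ b) j ≤ psum f j
interlacing-top g-dom g≤f nested total vanish zero = z≤n
interlacing-top {f} {g} {b} {x} {L} g-dom g≤f nested total vanish (suc j) = ⊔-lub
  (≤-trans (g-dom (suc j)) (psum-≤ (suc j)))
  (≤-trans (+-monoʳ-≤ x (g-dom j)) (+-cancelʳ-≤ (psum g M) _ _ (begin
    x + psum g j + psum g M          ≡⟨ +-assoc x _ _ ⟩
    x + (psum g j + psum g M)        ≡⟨ cong (x +_) (+-comm (psum g j) _) ⟩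
    x + (psum g M + psum g j)        ≡⟨ +-assoc x _ _ ⟨
    x + psum g M + psum g j          ≡⟨ cong (λ e → x + e + psum g j) (trans (cong (psum g M +_) (vanish M (m≤n+m L j))) (+-identityʳ _)) ⟨
    x + psum g (suc M) + psum g j    ≡⟨ cong (_+ psum g j) (total (suc M) (m≤n⇒m≤1+n (m≤n+m L j))) ⟨
    psum f (suc M) + psum g j        ≤⟨ shifted L ⟩
    psum f (suc j) + psum g M        ∎)))
  where
  open ≤-Reasoning
  -- Far enough down that both totals are reached and row `suc M` of `g` is empty.
  M = j + L
  psum-≤ : ∀ k → psum g k ≤ psum f k
  psum-≤ zero    = z≤n
  psum-≤ (suc k) = +-mono-≤ (psum-≤ k) (g≤f (suc k) (s≤s z≤n))
  shifted : ∀ d → psum f (suc (j + d)) + psum g j ≤ psum f (suc j) + psum g (j + d)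
  shifted zero    rewrite +-identityʳ j = ≤-refl
  shifted (suc d) rewrite +-suc j d = begin
    psum f (suc (j + d)) + f (suc (suc (j + d))) + psum g j    ≡⟨ +-assoc (psum f (suc (j + d))) _ _ ⟩
    psum f (suc (j + d)) + (f (suc (suc (j + d))) + psum g j)  ≡⟨ cong (psum f (suc (j + d)) +_) (+-comm (f (suc (suc (j + d)))) _) ⟩
    psum f (suc (j + d)) + (psum g j + f (suc (suc (j + d))))  ≡⟨ +-assoc (psum f (suc (j + d))) _ _ ⟨
    psum f (suc (j + d)) + psum g j + f (suc (suc (j + d)))    ≤⟨ +-mono-≤ (shifted d) (nested (suc (j + d)) (s≤s z≤n)) ⟩
    psum f (suc j) + psum g (j + d) + g (suc (j + d))          ≡⟨ +-assoc (psum f (suc j)) _ _ ⟩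
    psum f (suc j) + psum g (suc (j + d))                      ∎

InD-intro : ∀ {μ i j} → 1 ≤ i → 1 ≤ j → j ≤ get μ i → InD μ i j
InD-intro {μ} {i} 1≤i 1≤j j≤μi = 1≤i , get≥1⇒≤length μ i (≤-trans 1≤j j≤μi) , 1≤j , j≤μi

module Semistandard (μ a : List ℕ) (μ-anti : Antitone (get μ)) (T : Tableau) (T∈ : STab μ a T) where

  ν : ℕ → ℕ → ℕ
  ν = rowCount μ T

  range = proj₁ T∈
  rows  = proj₁ (proj₂ T∈)
  cols  = proj₁ (proj₂ (proj₂ T∈))
  value = proj₂ (proj₂ (proj₂ T∈))

  ν-spec : ∀ q {i j} → 1 ≤ i → 1 ≤ j → j ≤ get μ i → T i j ≤ q ⇔ j ≤ ν q i
  ν-spec q {i} {j} 1≤i = count-down (λ j → T i j ≤? q) (get μ i)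
    (λ j 1≤j j<μi le → ≤-trans (rows i j (InD-intro {μ} 1≤i 1≤j (<⇒≤ j<μi)) (InD-intro {μ} 1≤i (s≤s z≤n) j<μi)) le) j

  -- For `m = 0` there is no cell to inspect, so the bound on the entry is only requested for a
  -- positive column.
  ≤ν : ∀ q {i} m → 1 ≤ i → m ≤ get μ i → (∀ {j} → 1 ≤ j → j ≡ m → T i j ≤ q) → m ≤ ν q i
  ≤ν q zero    1≤i m≤ le = z≤n
  ≤ν q (suc m) 1≤i m≤ le = Equivalence.to (ν-spec q 1≤i (s≤s z≤n) m≤) (le (s≤s z≤n) refl)

  ν-mono : ∀ q i → 1 ≤ i → ν q i ≤ ν (suc q) i
  ν-mono q i 1≤i = ≤ν (suc q) (ν q i) 1≤i (rowCount≤ μ T q i) λ { 1≤j refl →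
    m≤n⇒m≤1+n (Equivalence.from (ν-spec q 1≤i 1≤j (rowCount≤ μ T q i)) ≤-refl) }

  -- Strict columns: directly above an entry at most `suc q` stands an entry at most `q`.
  ν-nested : ∀ q i → 1 ≤ i → ν (suc q) (suc i) ≤ ν q i
  ν-nested q i 1≤i = ≤ν q (ν (suc q) (suc i)) 1≤i ≤μi λ { 1≤j refl →
    s≤s⁻¹ (≤-trans (cols i _ (InD-intro {μ} 1≤i 1≤j ≤μi) (InD-intro {μ} (s≤s z≤n) 1≤j (rowCount≤ μ T (suc q) (suc i))))
      (Equivalence.from (ν-spec (suc q) (s≤s z≤n) 1≤j (rowCount≤ μ T (suc q) (suc i))) ≤-refl)) }
    where
    ≤μi : ν (suc q) (suc i) ≤ get μ i
    ≤μi = ≤-trans (rowCount≤ μ T (suc q) (suc i)) (μ-anti i 1≤i)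

  ν-zero : ∀ i → 1 ≤ i → ν 0 i ≡ 0
  ν-zero i 1≤i = count-unique (λ j → T i j ≤? 0) (get μ i) z≤n λ j 1≤j j≤μi → mk⇔
    (λ le → contradiction (≤-trans (proj₁ (range i j (InD-intro {μ} 1≤i 1≤j j≤μi))) le) λ ())
    (λ j≤0 → contradiction (≤-trans 1≤j j≤0) λ ())

  ν-full : ∀ i → 1 ≤ i → ν (length a) i ≡ get μ i
  ν-full i 1≤i = count-all (λ j → T i j ≤? length a) (get μ i) λ j 1≤j j≤μi →
    proj₂ (range i j (InD-intro {μ} 1≤i 1≤j j≤μi))

  ν-antitone : ∀ q → Antitone (ν q)
  ν-antitone zero    i 1≤i = ≤-reflexive (trans (ν-zero (suc i) (s≤s z≤n)) (sym (ν-zero i 1≤i)))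
  ν-antitone (suc q) i 1≤i = ≤-trans (ν-nested q i 1≤i) (ν-mono q i 1≤i)

  ν-size : ∀ q → q ≤ length a → psum (ν q) (length μ) ≡ sum (take q a)
  ν-size zero    _   = psum-vanish (ν 0) {0} {length μ} (λ i 0<i → ν-zero i 0<i) z≤n
  ν-size (suc q) q<h = begin
    psum (ν (suc q)) (length μ)                       ≡⟨ countVal-suc μ T q ⟩
    psum (ν q) (length μ) + countVal μ T (suc q)      ≡⟨ cong₂ _+_ (ν-size q (<⇒≤ q<h)) (value (suc q) (s≤s z≤n) q<h) ⟩
    sum (take q a) + get a (suc q)                    ≡⟨ +-comm _ (get a (suc q)) ⟩
    get a (suc q) + sum (take q a)                    ≡⟨ sum-∷ʳ (take q a) _ ⟨
    sum (take q a ∷ʳ get a (suc q))                   ≡⟨ cong sum (take-suc-get a q<h) ⟨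
    sum (take (suc q) a)                              ∎
    where open ≡-Reasoning

  ν-total : ∀ q → q ≤ length a → ∀ j → length μ ≤ j → psum (ν q) j ≡ sum (take q a)
  ν-total q q≤h j len≤j = trans (psum-vanish (ν q) (λ _ → rowCount-beyond μ T q) len≤j) (ν-size q q≤h)

  -- The shape of a semistandard tableau dominates its weight. By induction on the letters: each one
  -- adds a horizontal strip, to which `interlacing-top` applies.
  ν-top : ∀ q → q ≤ length a → ∀ j → top (take q a) j ≤ psum (ν q) j
  ν-top zero    _   zero    = z≤n
  ν-top zero    _   (suc j) = z≤n
  ν-top (suc q) q<h j = ≤-trans (≤-reflexive (trans (cong (λ b → top b j) (take-suc-get a q<h)) (top-∷ʳ (take q a) x j)))
    (interlacing-top {L = length μ} (ν-top q (<⇒≤ q<h)) (ν-mono q) (ν-nested q)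
      (λ k len≤k → trans (ν-total (suc q) q<h k len≤k)
        (trans (trans (cong sum (take-suc-get a q<h)) (sum-∷ʳ (take q a) x))
          (cong (x +_) (sym (ν-total q (<⇒≤ q<h) k len≤k)))))
      (λ k len≤k → rowCount-beyond μ T q (s≤s len≤k)) j)
    where x = get a (suc q)

-- The search that defines the tableau

hits : List ℕ → List ℕ → ℕ → ℕ → ℕ → ℕ → Bool
hits μ a r row col i = (lSeq μ a r (suc i) ≡ᵇ row) ∧ (get (μSeq μ a r i) (lSeq μ a r (suc i)) ≡ᵇ col)

fill : ℕ → List ℕ → List ℕ → ℕ → ℕ → ℕ → ℕ → ℕ → ℕ
fill n μ a r row col i zero    = 0
fill n μ a r row col i (suc f) =
  if hits μ a r row col i then tOf a n i else fill n μ a r row col (suc i) f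

-- The local search of Stab has no name in scope; the left-hand side of
-- go-fill is inferred from the use in Stab-fill, after the fuel and the
-- parameter n have been separated.
mutual
  Stab-fill : ∀ n μ a r row col → Stab n μ a r row col ≡ fill n μ a r row col 0 n
  Stab-fill zero    μ a r row col = refl
  Stab-fill (suc m) μ a r row col with hits μ a r row col 0
  ... | true  = refl
  ... | false with suc m | 1
  ...   | n | i = go-fill n μ a r row col i m

  go-fill : ∀ n μ a r row col i f → _ ≡ fill n μ a r row col i f
  go-fill n μ a r row col i zero    = refl
  go-fill n μ a r row col i (suc f) with hits μ a r row col i
  ... | true  = refl
  ... | false = go-fill n μ a r row col (suc i) f

-- The process

record Interlaces (f₀ f : ℕ → ℕ) (l : ℕ) : Set where
  field
    nested : ∀ i → 1 ≤ i → f₀ (suc i) ≤ f i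
    beyond : ∀ i → l < i → f i ≡ f₀ i

-- The row after `l′` is still as long as in `f₀`, and row `l′` is strictly longer than it, so
-- losing one cell cannot make row `l′` shorter than row `suc l′` of `f₀`.
interlaces-step : ∀ {f₀ f f′ l l′} → Interlaces f₀ f l → l ≤ l′ → f (suc l′) < f l′ → Decrement f l′ f′ →
  Interlaces f₀ f′ l′
interlaces-step {f₀} {f} {f′} {l} {l′} I l≤l′ corner d = record { nested = nested′ ; beyond = beyond′ }
  where
  module D = Decrement d
  open Interlaces I
  nested′ : ∀ i → 1 ≤ i → f₀ (suc i) ≤ f′ i
  nested′ i 1≤i with i ≟ l′
  ... | yes refl = s≤s⁻¹ (subst₂ _<_ (beyond (suc i) (s≤s l≤l′)) (sym D.at) corner)
  ... | no  i≢l′ = ≤-trans (nested i 1≤i) (≤-reflexive (sym (D.off i i≢l′)))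
  beyond′ : ∀ i → l′ < i → f′ i ≡ f₀ i
  beyond′ i l′<i = trans (D.off i λ eq → <⇒≢ l′<i (sym eq)) (beyond i (≤-<-trans l≤l′ l′<i))

get≤sum : ∀ xs i → get xs i ≤ sum xs
get≤sum xs zero    = z≤n
get≤sum xs (suc i) = ≤-trans (m≤n+m _ (psum (get xs) i)) (psum≤sum xs (suc i))

module Construction (n : ℕ) (μ a : List ℕ) (r : ℕ)
  (μ⊢n : IsPartition n μ) (a⊨n : IsComposition n a) (μ⊵a : μ ⊵ sortDesc a)
  (r∈R : InR μ a r) (r≤s : r ≤ sIdx μ a) where

  μ^ : ℕ → List ℕ
  μ^ = μSeq μ a r

  l^ : ℕ → ℕ
  l^ = lSeq μ a r

  start : ℕ → ℕ
  start i = if inA a i then 1 else l^ i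

  -- The time at which exactly the letters greater than `p` have been removed.
  after : ℕ → ℕ
  after p = sum (drop p a)

  l^-suc : ∀ i → l^ (suc i) ≡ lmin (μ^ i) (aSeq μ a r i) (start i)
  l^-suc i with inA a i
  ... | true  = refl
  ... | false = refl

  part≥1 : ∀ {p} → p < length a → 1 ≤ get a (suc p)
  part≥1 {p} p<h = proj₁ a⊨n (suc p) (s≤s z≤n) p<h

  -- At time `i`, `y` copies of the letter `suc p` remain. With none left the next search belongs to
  -- another letter, hence the guards `1 ≤ y`.
  record Stage (i p y : ℕ) : Set where
    field
      weight  : aSeq μ a r i ≡ take p a ∷ʳ⁺ y
      shape   : μ^ i ≽ (y ∷ take p a)
      start≥1 : 1 ≤ y → 1 ≤ start i
      fits    : 1 ≤ y → y ≤ get (μ^ i) (start i)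

  record Step (i p z : ℕ) : Set where
    field
      shape  : μ^ i ≽ (suc z ∷ take p a)
      inR    : InR (μ^ i) (aSeq μ a r i) (l^ (suc i))
      start≤ : start i ≤ l^ (suc i)
      fits   : suc z ≤ get (μ^ i) (l^ (suc i))
      least  : ∀ x → start i ≤ x → x < l^ (suc i) → ¬ Removable (get (μ^ i)) (z ∷ take p a) x

    decrement : Decrement (get (μ^ i)) (l^ (suc i)) (get (μ^ (suc i)))
    decrement = InR-Decrement {μ^ i} {aSeq μ a r i} inR

    corner : get (μ^ i) (suc (l^ (suc i))) < get (μ^ i) (l^ (suc i))
    corner = proj₁ (proj₂ (proj₂ inR))

  step : ∀ {i p z} → Stage i p (suc z) → Step i p z
  step {i} {p} {z} st = record
    { shape  = shape
    ; inR    = subst₂ (InR (μ^ i)) (sym weight) eq (proj₁ spec)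
    ; start≤ = subst (start i ≤_) eq (proj₁ (proj₂ spec))
    ; fits   = subst (λ l → suc z ≤ get (μ^ i) l) eq (proj₁ (proj₂ (proj₂ spec)))
    ; least  = subst (λ l → ∀ x → start i ≤ x → x < l → ¬ Removable (get (μ^ i)) (z ∷ take p a) x) eq
                 (proj₂ (proj₂ (proj₂ spec)))
    }
    where
    open Stage st
    eq : lmin (μ^ i) (take p a ∷ʳ suc z) (start i) ≡ l^ (suc i)
    eq = sym (trans (l^-suc i) (cong (λ w → lmin (μ^ i) w (start i)) weight))
    spec = lmin-step shape (start≥1 (s≤s z≤n)) (fits (s≤s z≤n))

  start-inside : ∀ {p k} → p < length a → suc k < get a (suc p) →
    start (suc k + after (suc p)) ≡ l^ (suc k + after (suc p))
  start-inside {p} {k} p<h k<a =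
    cong (λ b → if b then 1 else l^ (suc k + after (suc p))) (inA-false a p<h k<a (inj₁ (s≤s z≤n)))

  -- The row just used had at least `suc z` cells and keeps at least `z`, which is what a search for
  -- the remaining copies, starting at that same row, requires.
  advance : ∀ {p k z} → p < length a → k + suc z ≡ get a (suc p) →
    Stage (k + after (suc p)) p (suc z) → Stage (suc k + after (suc p)) p z
  advance {p} {k} {z} p<h eq st = record
    { weight  = trans (cong tilde (Stage.weight st)) (tilde-∷ʳ (take p a) z)
    ; shape   = ≽-remove (Stage.shape st)
        (subst (λ w → InR (μ^ i) w (l^ (suc i))) (Stage.weight st) (Step.inR s))
    ; start≥1 = λ 1≤z → subst (1 ≤_) (sym (start-inside p<h (inside 1≤z))) (proj₁ (Step.inR s))
    ; fits    = λ 1≤z → subst (λ l → z ≤ get (μ^ (suc i)) l) (sym (start-inside p<h (inside 1≤z)))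
        (s≤s⁻¹ (subst (suc z ≤_) (sym (Decrement.at (Step.decrement s))) (Step.fits s)))
    }
    where
    i = k + after (suc p)
    s : Step i p z
    s = step st
    inside : 1 ≤ z → suc k < get a (suc p)
    inside 1≤z = ≤-trans (≤-reflexive (cong suc (+-comm 1 k)))
      (≤-trans (≤-reflexive (sym (+-suc k 1))) (≤-trans (+-monoʳ-≤ k (s≤s 1≤z)) (≤-reflexive eq)))

  last-index : ∀ {p} → suc p ≡ length a → after (suc p) ≡ 0
  last-index eq = trans (cong after eq) (cong sum (drop-length a))

  a-last : ∀ {p} → suc p ≡ length a → a ≡ take p a ∷ʳ get a (suc p)
  a-last {p} eq = trans (sym (take-all (suc p) a (≤-reflexive (sym eq)))) (take-suc-get a (≤-reflexive eq))

  start-0 : ∀ {p} → suc p ≡ length a → start 0 ≡ r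
  start-0 {p} eq = cong (λ b → if b then 1 else r)
    (subst (λ i → inA a i ≡ false) (last-index eq)
      (inA-false a (≤-reflexive eq) (part≥1 (≤-reflexive eq)) (inj₂ eq)))

  μ-antitone : Antitone (get μ)
  μ-antitone = proj₂ μ⊢n

  -- The first search starts at `r`, because time 0 is not in A. The bound `r ≤ sIdx μ a` makes row
  -- `r` long enough for the last part.
  initial : ∀ {p} → suc p ≡ length a → Stage 0 p (get a (suc p))
  initial {p} eq = record
    { weight  = trans (a-last eq) (sym (∷ʳ⁺-pos (take p a) (part≥1 (≤-reflexive eq))))
    ; shape   = record
      { positive  = proj₁ (proj₁ μ⊢n)
      ; antitone  = μ-antitone
      ; size      = trans sizes (trans (cong sum (a-last eq)) (sum-∷ʳ (take p a) y))
      ; dominates = λ j → ≤-trans (≤-reflexive (tops j)) (⊵-elim {μ} {sortDesc a}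
          (≤-reflexive (trans (sum-sortDesc a) (sym sizes))) μ⊵a j)
      }
    ; start≥1 = λ _ → subst (1 ≤_) (sym (start-0 eq)) (proj₁ r∈R)
    ; fits    = λ _ → subst₂ (λ j l → get a j ≤ get μ l) (sym eq) (sym (start-0 eq))
        (sIdx-spec a μ-antitone (proj₁ r∈R) r≤s)
    }
    where
    y = get a (suc p)
    sizes : sum μ ≡ sum a
    sizes = trans (proj₂ (proj₁ μ⊢n)) (sym (proj₂ a⊨n))
    tops : ∀ j → top (y ∷ take p a) j ≡ psum (get (sortDesc a)) j
    tops j = begin
      top (y ∷ take p a) j       ≡⟨ top-∷ʳ (take p a) y j ⟨
      top (take p a ∷ʳ y) j      ≡⟨ cong (λ b → top b j) (a-last eq) ⟨
      top a j                    ≡⟨ psum-sortDesc a j ⟨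
      psum (get (sortDesc a)) j  ∎
      where open ≡-Reasoning

  start-restart : ∀ {p} → suc p < length a → start (after (suc p)) ≡ 1
  start-restart {p} p+1<h = cong (λ b → if b then 1 else l^ (after (suc p))) (inA-true a (s≤s z≤n) p+1<h)

  -- When the letter changes the search restarts at row 1, and dominance at `j = 1` makes that row
  -- at least as long as the new last part.
  next : ∀ {p} → suc p < length a → Stage (after (suc p)) (suc p) 0 → Stage (after (suc p)) p (get a (suc p))
  next {p} p+1<h st = record
    { weight  = trans weight (trans (take-suc-get a p<h) (sym (∷ʳ⁺-pos (take p a) (part≥1 p<h))))
    ; shape   = record
      { positive  = positive
      ; antitone  = antitone
      ; size      = trans size (trans (cong sum (take-suc-get a p<h)) (sum-∷ʳ (take p a) y))
      ; dominates = dom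
      }
    ; start≥1 = λ _ → subst (1 ≤_) (sym (start-restart p+1<h)) ≤-refl
    ; fits    = λ _ → subst (λ l → y ≤ get ρ l) (sym (start-restart p+1<h))
        (≤-trans (≤-reflexive (sym (+-identityʳ y))) (≤-trans (top-pick y (take p a) 0) (dom 1)))
    }
    where
    open Stage st
    open _≽_ shape
    ρ = μ^ (after (suc p))
    y = get a (suc p)
    p<h : p < length a
    p<h = <-trans (n<1+n p) p+1<h
    dom : ∀ j → top (y ∷ take p a) j ≤ psum (get ρ) j
    dom j = ≤-trans (≤-reflexive (begin
      top (y ∷ take p a) j       ≡⟨ top-∷ʳ (take p a) y j ⟨
      top (take p a ∷ʳ y) j      ≡⟨ cong (λ b → top b j) (take-suc-get a p<h) ⟨
      top (take (suc p) a) j     ≡⟨ top-0∷ (take (suc p) a) j ⟨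
      top (0 ∷ take (suc p) a) j ∎)) (dominates j)
      where open ≡-Reasoning

  -- `d` is the number of letters greater than `suc p`. A block starts from the end of the block of
  -- the next larger letter or, for `d = 0`, from the initial state; within it the induction is on
  -- `k`.
  stage′ : ∀ d p → suc p + d ≡ length a → ∀ k y → k + y ≡ get a (suc p) → Stage (k + after (suc p)) p y
  stage′ zero p eq zero y refl = subst (λ i → Stage i p (get a (suc p))) (sym (last-index last)) (initial last)
    where
    last : suc p ≡ length a
    last = trans (sym (+-identityʳ (suc p))) eq
  stage′ (suc d) p eq zero y refl = next p+1<h
    (subst (λ i → Stage i (suc p) 0) (sum-drop-suc a p+1<h)
      (stage′ d (suc p) eq′ (get a (suc (suc p))) 0 (+-identityʳ _)))
    where
    eq′ : suc (suc p) + d ≡ length a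
    eq′ = trans (sym (+-suc (suc p) d)) eq
    p+1<h : suc p < length a
    p+1<h = ≤-trans (m≤m+n (suc (suc p)) d) (≤-reflexive eq′)
  stage′ d p eq (suc k) y k+y = advance p<h (trans (+-suc k y) k+y) (stage′ d p eq k (suc y) (trans (+-suc k y) k+y))
    where
    p<h : p < length a
    p<h = ≤-trans (m≤m+n (suc p) d) (≤-reflexive eq)

  stage : ∀ {p k y} → p < length a → k + y ≡ get a (suc p) → Stage (k + after (suc p)) p y
  stage {p} {k} {y} p<h eq = stage′ (length a ∸ suc p) p (m+[n∸m]≡n p<h) k y eq

  step-at : ∀ {i} → i < n → ∃[ p ] ∃[ z ] Step i p z
  step-at {i} i<n with suffix-position a (subst (i <_) (sym (proj₂ a⊨n)) i<n)
  ... | p , k , p<h , k<a , refl = p , get a (suc p) ∸ suc k ,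
    step (stage p<h (trans (+-suc k _) (m+[n∸m]≡n k<a)))

  -- While copies of the letter remain after the first removal, `start` is the row used last. When
  -- the block ends `start` may already be reset to 1, so the final row is only asserted to exist.
  block-induction : (Q : ℕ → ℕ → Set) → ∀ {p} → p < length a →
    Q (after (suc p)) (start (after (suc p))) →
    (∀ {i z} → Step i p z → Q i (start i) → Q (suc i) (l^ (suc i))) →
    ∃[ l ] Q (after p) l
  block-induction Q {p} p<h base ind =
    subst (λ i → ∃[ l ] Q i l) (sum-drop-suc a p<h) (run (get a (suc p)) 0 (+-identityʳ _))
    where
    run : ∀ k z → k + z ≡ get a (suc p) → ∃[ l ] Q (k + after (suc p)) l
    run⁺ : ∀ k z → k + suc z ≡ get a (suc p) → Q (k + after (suc p)) (start (k + after (suc p)))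
    run zero    z eq = _ , base
    run (suc k) z eq = _ , ind (step (stage p<h eq′)) (run⁺ k z eq′)
      where eq′ = trans (+-suc k z) eq
    run⁺ zero    z eq = base
    run⁺ (suc k) z eq = subst (Q (suc k + after (suc p)))
      (sym (start-inside p<h (≤-trans (m≤m+n (suc (suc k)) z) (≤-reflexive (trans (sym (+-suc (suc k) z)) eq)))))
      (ind (step (stage p<h eq′)) (run⁺ k (suc z) eq′))
      where eq′ = trans (+-suc k (suc z)) eq

  -- The shapes between two letters

  shape≽ : ∀ {p} → p < length a → μ^ (after p) ≽ (0 ∷ take p a)
  shape≽ {p} p<h = subst (λ i → μ^ i ≽ (0 ∷ take p a)) (sum-drop-suc a p<h)
    (Stage.shape (stage {p} {get a (suc p)} {0} p<h (+-identityʳ _)))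

  μ^-last : μ^ (after (length a)) ≡ μ
  μ^-last = cong (λ xs → μ^ (sum xs)) (drop-length a)

  shape-size : ∀ {p} → p ≤ length a → sum (μ^ (after p)) ≡ sum (take p a)
  shape-size {p} p≤h with m≤n⇒m<n∨m≡n p≤h
  ... | inj₁ p<h  = _≽_.size (shape≽ p<h)
  ... | inj₂ refl = begin
    sum (μ^ (after (length a)))  ≡⟨ cong sum μ^-last ⟩
    sum μ                        ≡⟨ proj₂ (proj₁ μ⊢n) ⟩
    n                            ≡⟨ proj₂ a⊨n ⟨
    sum a                        ≡⟨ cong sum (take-all (length a) a ≤-refl) ⟨
    sum (take (length a) a)      ∎
    where open ≡-Reasoning

  -- `Interlaces` holds when the block begins because the shape is a partition, and the weakly
  -- increasing choice of rows preserves it.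
  shape-nested : ∀ {p} → p < length a → ∀ i → 1 ≤ i → get (μ^ (after (suc p))) (suc i) ≤ get (μ^ (after p)) i
  shape-nested {p} p<h = Interlaces.nested (proj₂ (block-induction
    (λ i l → Interlaces (get ρ) (get (μ^ i)) l) p<h
    (record { nested = _≽_.antitone (Stage.shape (stage {p} {0} p<h refl)) ; beyond = λ _ _ → refl })
    λ s I → interlaces-step I (Step.start≤ s) (Step.corner s) (Step.decrement s)))
    where ρ = μ^ (after (suc p))

  -- For the largest letter the search starts at `r` and never moves back up.
  shape-rows<r : ∀ {p} → suc p ≡ length a → ∀ i → i < r → get (μ^ (after p)) i ≡ get μ i
  shape-rows<r {p} eq = proj₂ (proj₂ (block-induction
    (λ i l → r ≤ l × (∀ x → x < r → get (μ^ i) x ≡ get μ x)) (≤-reflexive eq)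
    (subst (λ i → r ≤ start i × (∀ x → x < r → get (μ^ i) x ≡ get μ x)) (sym (last-index eq))
      (≤-reflexive (sym (start-0 eq)) , λ _ _ → refl))
    λ { {i} s (r≤l , same) → let r≤l′ = ≤-trans r≤l (Step.start≤ s) in r≤l′ , λ x x<r →
      trans (Decrement.off (Step.decrement s) x λ e → <⇒≢ (≤-trans x<r r≤l′) e) (same x x<r) }))

  μ^-antitone : ∀ {i j} → i ≤ j → ∀ x → get (μ^ j) x ≤ get (μ^ i) x
  μ^-antitone {i} {j} i≤j x with m≤n⇒m<n∨m≡n i≤j
  ... | inj₂ refl = ≤-refl
  μ^-antitone {i} {suc j} i≤j x | inj₁ (s≤s i≤j′) = ≤-trans
    (≤-trans (≤-reflexive (get-strip (decAt (μ^ j) (l^ (suc j))) x)) (get-decAt-≤ (μ^ j) (l^ (suc j)) x))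
    (μ^-antitone i≤j′ x)

  μ^-exhausted : ∀ x → get (μ^ n) x ≡ 0
  μ^-exhausted x = n≤0⇒n≡0 (≤-trans (get≤sum (μ^ n) x) (≤-reflexive
    (trans (cong (λ i → sum (μ^ i)) (sym (proj₂ a⊨n))) (shape-size {0} z≤n))))

  -- The filling

  hits-yes : ∀ {row col i} → hits μ a r row col i ≡ true → l^ (suc i) ≡ row × get (μ^ i) row ≡ col
  hits-yes {row} {col} {i} eq = row≡ , trans (cong (get (μ^ i)) (sym row≡))
    (≡ᵇ⇒≡ (get (μ^ i) (l^ (suc i))) col (proj₂ both))
    where
    both = Equivalence.to T-∧ (Equivalence.from T-≡ eq)
    row≡ : l^ (suc i) ≡ row
    row≡ = ≡ᵇ⇒≡ (l^ (suc i)) row (proj₁ both)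

  hits-no : ∀ {row col i} → hits μ a r row col i ≡ false → l^ (suc i) ≡ row → get (μ^ i) row ≢ col
  hits-no {row} {col} {i} eq refl refl =
    contradiction (trans (sym (cong₂ _∧_ (≡ᵇ-true {row} refl) (≡ᵇ-true {col} refl))) eq) λ ()

  -- A row loses its cells one at a time from the right and is empty at time `n`, so each of its
  -- cells is hit, exactly when the row length drops below `col`.
  fill-time : ∀ f {i row col} → i + f ≡ n → 1 ≤ col → col ≤ get (μ^ i) row →
    ∃[ k ] (k < n × fill n μ a r row col i f ≡ tOf a n k × col ≤ get (μ^ k) row × get (μ^ (suc k)) row < col)
  fill-time zero {i} {row} eq 1≤col col≤ = contradiction
    (≤-trans 1≤col (≤-trans col≤ (≤-reflexive (trans
      (cong (λ j → get (μ^ j) row) (trans (sym (+-identityʳ i)) eq)) (μ^-exhausted row))))) λ ()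
  fill-time (suc f) {i} {row} {col} eq 1≤col col≤ with hits μ a r row col i in hit
  ... | true  = i , i<n , refl , col≤ , leaves (hits-yes {row} {col} {i} hit)
    where
    i<n : i < n
    i<n = ≤-trans (m<m+n i (s≤s z≤n)) (≤-reflexive eq)
    leaves : l^ (suc i) ≡ row × get (μ^ i) row ≡ col → get (μ^ (suc i)) row < col
    leaves (refl , col≡) = ≤-reflexive (trans (Decrement.at (Step.decrement (proj₂ (proj₂ (step-at i<n))))) col≡)
  ... | false = fill-time f (trans (sym (+-suc i f)) eq) 1≤col (stays (row ≟ l^ (suc i)))
    where
    i<n : i < n
    i<n = ≤-trans (m<m+n i (s≤s z≤n)) (≤-reflexive eq)
    d = Step.decrement (proj₂ (proj₂ (step-at i<n)))
    stays : Dec (row ≡ l^ (suc i)) → col ≤ get (μ^ (suc i)) row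
    stays (no row≢) = ≤-trans col≤ (≤-reflexive (sym (Decrement.off d row row≢)))
    stays (yes refl) = s≤s⁻¹ (≤-trans (≤∧≢⇒< col≤ (λ e → hits-no {row} {col} {i} hit refl (sym e)))
      (≤-reflexive (sym (Decrement.at d))))

  n-split : ∀ q → n ≡ sum (take q a) + after q
  n-split q = trans (sym (proj₂ a⊨n)) (sym (sum-take-drop a q))

  cut : ∀ {i} q → n ∸ i ≤ sum (take q a) ⇔ after q ≤ i
  cut {i} q = mk⇔
    (λ le → +-cancelˡ-≤ (sum (take q a)) _ _ (≤-trans (≤-reflexive (sym (n-split q)))
      (≤-trans (m≤n+m∸n n i) (≤-trans (+-monoʳ-≤ i le) (≤-reflexive (+-comm i _))))))
    (λ le → m≤n+o⇒m∸n≤o n i (≤-trans (≤-reflexive (n-split q))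
      (≤-trans (+-monoʳ-≤ (sum (take q a)) le) (≤-reflexive (+-comm _ i)))))

  -- By `cut`, the test for `t` says that `i` lies from `after t` on but before `after (t ∸ 1)`. As
  -- `after` is antitone, this locates `t` relative to every `q`.
  tOf-≤ : ∀ {i} → i < n → ∀ q → tOf a n i ≤ q ⇔ after q ≤ i
  tOf-≤ {i} i<n q with suffix-position a (subst (i <_) (sym (proj₂ a⊨n)) i<n)
  ... | p , k , p<h , k<a , refl = result
    where
    test : ℕ → Bool
    test t = (sum (take (t ∸ 1) a) <ᵇ n ∸ i) ∧ (n ∸ i ≤ᵇ sum (take t a))
    -- The letter given by `suffix-position` passes the test, so the search does not return its
    -- default 0.
    test-suc-p : test (suc p) ≡ true
    test-suc-p = Equivalence.to T-≡ (Equivalence.from T-∧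
      ( <⇒<ᵇ (≰⇒> λ le → <-irrefl refl (≤-trans
          (≤-trans (+-monoˡ-< (after (suc p)) k<a) (≤-reflexive (sum-drop-suc a p<h)))
          (Equivalence.to (cut p) le)))
      , ≤⇒≤ᵇ (Equivalence.from (cut (suc p)) (m≤n+m (after (suc p)) k))))
    result : tOf a n i ≤ q ⇔ after q ≤ i
    result with firstFrom test 1 (length a) | firstFrom-least test 1 (length a) {suc p} (s≤s z≤n) (s≤s p<h) test-suc-p
    ... | .(just t) | t , refl , pt , 1≤t , t≤p , _ = mk⇔
      (λ t≤q → ≤-trans (sum-drop-antitone a t≤q) (Equivalence.to (cut t) (≤ᵇ⇒≤ _ _ (proj₂ both))))
      (λ le → ≮⇒≥ λ q<t → <-irrefl refl (≤-trans (<ᵇ⇒< _ _ (proj₁ both))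
        (Equivalence.from (cut (t ∸ 1)) (≤-trans (sum-drop-antitone a (m+n≤o⇒m≤o∸n q (≤-trans (≤-reflexive (+-comm q 1)) q<t))) le))))
      where both = Equivalence.to T-∧ (Equivalence.from T-≡ pt)

  S : Tableau
  S = Stab n μ a r

  -- The cell disappears in the step at time `k`, and row lengths only decrease. So it is present at
  -- time `after q` exactly when `after q ≤ k`, which by `tOf-≤` bounds its letter by `q`.
  S-≤ : ∀ {row col} → 1 ≤ col → col ≤ get μ row → ∀ q → S row col ≤ q ⇔ col ≤ get (μ^ (after q)) row
  S-≤ {row} {col} 1≤col col≤ q with fill-time n {0} {row} {col} refl 1≤col col≤
  ... | k , k<n , eq , col≤k , col>k = mk⇔
    (λ le → ≤-trans col≤k (μ^-antitone
      (Equivalence.to (tOf-≤ k<n q) (≤-trans (≤-reflexive (sym S≡)) le)) row))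
    (λ le → ≤-trans (≤-reflexive S≡) (Equivalence.from (tOf-≤ k<n q)
      (≮⇒≥ λ k<after → <-irrefl refl (≤-trans col>k (≤-trans le (μ^-antitone k<after row))))))
    where
    S≡ : S row col ≡ tOf a n k
    S≡ = trans (Stab-fill n μ a r row col) eq

  -- The greedy tableau is semistandard and lies in the subposet

  h : ℕ
  h = length a

  shape : ℕ → ℕ → ℕ
  shape q = get (μ^ (after q))

  shape-full : ∀ i → shape h i ≡ get μ i
  shape-full i = cong (λ ρ → get ρ i) μ^-last

  shape-empty : ∀ i → shape 0 i ≡ 0
  shape-empty i = trans (cong (λ m → get (μ^ m) i) (proj₂ a⊨n)) (μ^-exhausted i)

  shape-total : ∀ {q} → q ≤ h → ∀ j → length μ ≤ j → psum (shape q) j ≡ sum (take q a)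
  shape-total {q} q≤h j len≤j = begin
    psum (shape q) j                    ≡⟨ psum-vanish (shape q) (λ i j<i → vanish i (≤-<-trans len≤j j<i)) (m≤m+n j _) ⟨
    psum (shape q) (j + length ρ)       ≡⟨ psum-all ρ (m≤n+m _ j) ⟩
    sum ρ                               ≡⟨ shape-size q≤h ⟩
    sum (take q a)                      ∎
    where
    open ≡-Reasoning
    ρ = μ^ (after q)
    vanish : ∀ i → length μ < i → shape q i ≡ 0
    vanish i len<i = n≤0⇒n≡0 (≤-trans (μ^-antitone {0} {after q} z≤n i) (≤-reflexive (get-beyond μ i len<i)))

  rowCount-S : ∀ q i → rowCount μ S q i ≡ shape q i
  rowCount-S q i = count-unique (λ j → S i j ≤? q) (get μ i) (μ^-antitone {0} {after q} z≤n i)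
    λ j 1≤j j≤μi → S-≤ 1≤j j≤μi q

  S-range : ∀ i j → InD μ i j → 1 ≤ S i j × S i j ≤ h
  S-range i j (_ , _ , 1≤j , j≤μi) =
    ≰⇒> (λ S≤0 → contradiction
      (≤-trans 1≤j (≤-trans (Equivalence.to (S-≤ 1≤j j≤μi 0) S≤0) (≤-reflexive (shape-empty i)))) λ ()) ,
    Equivalence.from (S-≤ 1≤j j≤μi h) (≤-trans j≤μi (≤-reflexive (sym (shape-full i))))

  S-col : ∀ i j → InD μ i j → InD μ (suc i) j → S i j < S (suc i) j
  S-col i j (1≤i , _ , 1≤j , j≤μi) below@(_ , _ , _ , j≤μi+1)
    with S (suc i) j | S-range (suc i) j below | Equivalence.to (S-≤ 1≤j j≤μi+1 (S (suc i) j)) ≤-refl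
  -- The lower cell survives in the shape for `suc p`, so by interlacing the cell above it survives
  -- in the shape for `p`.
  ... | suc p | _ , p<h | j≤shape =
    s≤s (Equivalence.from (S-≤ 1≤j j≤μi p) (≤-trans j≤shape (shape-nested p<h i 1≤i)))

  S-value : ∀ p → 1 ≤ p → p ≤ h → countVal μ S p ≡ get a p
  S-value (suc p) _ p<h = +-cancelˡ-≡ (sum (take p a)) _ _ (begin
    sum (take p a) + countVal μ S (suc p)                        ≡⟨ cong (_+ countVal μ S (suc p)) (total (<⇒≤ p<h)) ⟨
    psum (rowCount μ S p) (length μ) + countVal μ S (suc p)      ≡⟨ countVal-suc μ S p ⟨
    psum (rowCount μ S (suc p)) (length μ)                       ≡⟨ total p<h ⟩
    sum (take (suc p) a)                                         ≡⟨ cong sum (take-suc-get a p<h) ⟩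
    sum (take p a ∷ʳ get a (suc p))                              ≡⟨ sum-∷ʳ (take p a) _ ⟩
    get a (suc p) + sum (take p a)                               ≡⟨ +-comm (get a (suc p)) _ ⟩
    sum (take p a) + get a (suc p)                               ∎)
    where
    open ≡-Reasoning
    total : ∀ {q} → q ≤ h → psum (rowCount μ S q) (length μ) ≡ sum (take q a)
    total {q} q≤h = trans (psum-cong (λ i _ → rowCount-S q i) (length μ)) (shape-total q≤h (length μ) ≤-refl)

  S∈STab : STab μ a S
  S∈STab = S-range
    , (λ { i j (_ , _ , 1≤j , j≤μi) (_ , _ , _ , j<μi) → Equivalence.from (S-≤ 1≤j j≤μi (S i (suc j)))
          (<⇒≤ (Equivalence.to (S-≤ (s≤s z≤n) j<μi (S i (suc j))) ≤-refl)) })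
    , S-col , S-value

  S∈SubTab : SubTab μ a r S
  S∈SubTab = S∈STab , λ i 1≤i i≤len S≡h → ≮⇒≥ λ i<r → absurd i 1≤i i≤len S≡h i<r h refl
    where
    -- `m` stands for `h` so that it can be split into zero and successor. In the successor case row
    -- `i` is still complete once the largest letter is gone, so its last entry is smaller than `h`.
    absurd : ∀ i → 1 ≤ i → i ≤ length μ → S i (get μ i) ≡ h → i < r → ∀ m → m ≡ h → ⊥
    absurd i 1≤i i≤len S≡h i<r m m≡h with proj₁ (proj₁ μ⊢n) i 1≤i i≤len
    absurd i 1≤i i≤len S≡h i<r zero m≡h | 1≤μi = contradiction
      (≤-trans (proj₁ (S-range i (get μ i) (1≤i , i≤len , 1≤μi , ≤-refl))) (≤-reflexive (trans S≡h (sym m≡h)))) λ ()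
    absurd i 1≤i i≤len S≡h i<r (suc p) m≡h | 1≤μi = <-irrefl refl (≤-trans (≤-reflexive (trans m≡h (sym S≡h)))
      (Equivalence.from (S-≤ 1≤μi ≤-refl p) (≤-reflexive (sym (shape-rows<r m≡h i i<r)))))

  -- Comparison with an arbitrary tableau

  module _ (T : Tableau) (T∈ : STab μ a T) where

    open Semistandard μ a μ-antitone T T∈

    -- The letters of `T` below `h` fill the rows above row `r` completely. This is the common form
    -- in which both versions of the minimality claim enter the comparison.
    Avoids : Set
    Avoids = ∀ {p} → suc p ≡ h → ∀ j → j < r → psum (get μ) j ≤ psum (ν p) j

    shape-least : Avoids → ∀ {p} → p < h → (∀ i → 1 ≤ i → ν (suc p) i ≡ shape (suc p) i) →
      ∀ j → psum (shape p) j ≤ psum (ν p) j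
    shape-least avoids {p} p<h same = ahead-final (length μ)
      (proj₂ (block-induction (λ i l → Ahead (get (μ^ i)) l (ν p)) p<h base
        λ s A → ahead-step (Step.shape s) (ν-top p (<⇒≤ p<h)) A (Step.start≤ s) (Step.least s) (Step.decrement s)))
      λ j len≤j → trans (shape-total (<⇒≤ p<h) j len≤j) (sym (ν-total p (<⇒≤ p<h) j len≤j))
      where
      below : ∀ j → j < start (after (suc p)) → psum (shape (suc p)) j ≤ psum (ν p) j
      -- For a letter smaller than `h` the search starts at row 1 and only `j = 0` occurs. For `h`
      -- it starts at `r`, and `Avoids` supplies the inequality.
      below j j<start with m≤n⇒m<n∨m≡n p<h
      ... | inj₁ p+1<h with j | subst (j <_) (start-restart p+1<h) j<start
      ...   | zero  | _ = z≤n
      ...   | suc _ | s≤s ()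
      below j j<start | inj₂ last = ≤-trans
        (≤-reflexive (psum-cong (λ i _ → trans (cong (λ q → shape q i) last) (shape-full i)) j))
        (avoids last j (subst (j <_) (trans (cong start (last-index last)) (start-0 last)) j<start))
      base : Ahead (shape (suc p)) (start (after (suc p))) (ν p)
      base = record
        { below  = below
        ; beyond = λ i l<i → let 1≤i = ≤-trans (s≤s z≤n) l<i in
            ≤-trans (ν-mono p i 1≤i) (≤-reflexive (same i 1≤i))
        ; nested = λ i 1≤i → ≤-trans (≤-reflexive (sym (same (suc i) (s≤s z≤n)))) (ν-nested p i 1≤i)
        }

    tau-rowCount : ∀ {q} → tau μ T q ≡ tau μ S q → ∀ i → 1 ≤ i → ν q i ≡ shape q i
    tau-rowCount {q} eq i 1≤i = begin
      ν q i              ≡⟨ get-tau μ T q i 1≤i ⟨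
      get (tau μ T q) i  ≡⟨ cong (λ xs → get xs i) eq ⟩
      get (tau μ S q) i  ≡⟨ get-tau μ S q i 1≤i ⟩
      rowCount μ S q i   ≡⟨ rowCount-S q i ⟩
      shape q i          ∎
      where open ≡-Reasoning

    tau-h : tau μ T h ≡ tau μ S h
    tau-h = cong strip (map-cong
      (λ { zero → refl
         ; (suc i) → trans (ν-full (suc i) (s≤s z≤n)) (sym (trans (rowCount-S h (suc i)) (shape-full (suc i)))) })
      (range1 (length μ)))

    tau-⊵ : Avoids → ∀ {q} → q < h → tau μ T (suc q) ≡ tau μ S (suc q) → tau μ T q ⊵ tau μ S q
    tau-⊵ avoids {q} q<h eq = ⊵-intro (tau-positive μ T q (ν-antitone q))
      (begin-equality
        sum (tau μ T q)                     ≡⟨ sum-tau μ T q ⟩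
        psum (ν q) (length μ)               ≡⟨ ν-size q (<⇒≤ q<h) ⟩
        sum (take q a)                      ≡⟨ shape-total (<⇒≤ q<h) (length μ) ≤-refl ⟨
        psum (shape q) (length μ)           ≡⟨ psum-cong (λ i _ → rowCount-S q i) (length μ) ⟨
        psum (rowCount μ S q) (length μ)    ≡⟨ sum-tau μ S q ⟨
        sum (tau μ S q)                     ∎)
      λ j → begin
        psum (get (tau μ S q)) j  ≡⟨ psum-cong (λ i 1≤i → trans (get-tau μ S q i 1≤i) (rowCount-S q i)) j ⟩
        psum (shape q) j          ≤⟨ shape-least avoids q<h (tau-rowCount eq) j ⟩
        psum (ν q) j              ≡⟨ psum-cong (get-tau μ T q) j ⟨
        psum (get (tau μ T q)) j  ∎
      where open ≤-Reasoning

    same-entries : (∀ q → 1 ≤ q → q ≤ h → tau μ T q ≡ tau μ S q) → ∀ i j → InD μ i j → S i j ≡ T i j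
    same-entries eq i j d@(1≤i , _ , 1≤j , j≤μi) = ≤-antisym
      (Equivalence.from (S-≤ 1≤j j≤μi (T i j)) (≤-trans (Equivalence.to (ν-spec (T i j) 1≤i 1≤j j≤μi) ≤-refl)
        (≤-reflexive (tau-rowCount (eq (T i j) (proj₁ (range i j d)) (proj₂ (range i j d))) i 1≤i))))
      (Equivalence.from (ν-spec (S i j) 1≤i 1≤j j≤μi) (≤-trans (Equivalence.to (S-≤ 1≤j j≤μi (S i j)) ≤-refl)
        (≤-reflexive (sym (tau-rowCount (eq (S i j) (proj₁ (S-range i j d)) (proj₂ (S-range i j d))) i 1≤i)))))

    -- Descend from `h` to the first `p` where the shapes differ. It is not `h`, where both shapes
    -- are the whole of `μ`; so the shapes for `p + 1` agree and `tau-⊵` applies at `p`.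
    S≤T : Avoids → TabLe μ a S T
    S≤T avoids = search h ≤-refl λ q h<q q≤h → contradiction (≤-trans h<q q≤h) (<-irrefl refl)
      where
      search : ∀ q → q ≤ h → (∀ q′ → q < q′ → q′ ≤ h → tau μ T q′ ≡ tau μ S q′) → TabLe μ a S T
      search zero    _   agree = inj₁ (same-entries agree)
      search (suc q) q<h agree with ≡-dec _≟_ (tau μ T (suc q)) (tau μ S (suc q))
      ... | yes eq = search q (<⇒≤ q<h) agree′
        where
        agree′ : ∀ q′ → q < q′ → q′ ≤ h → tau μ T q′ ≡ tau μ S q′
        agree′ q′ q<q′ q′≤h with m≤n⇒m<n∨m≡n q<q′
        ... | inj₁ lt   = agree q′ lt q′≤h
        ... | inj₂ refl = eq
      ... | no ≢ with m≤n⇒m<n∨m≡n q<h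
      ...   | inj₁ q+1<h = inj₂ (suc q , s≤s z≤n , q<h , agree ,
                tau-⊵ avoids q+1<h (agree (suc (suc q)) ≤-refl q+1<h) , ≢)
      ...   | inj₂ last  = contradiction (subst (λ m → tau μ T m ≡ tau μ S m) (sym last) tau-h) ≢

    -- A row above row `r` does not end in `h`, and rows weakly increase, so all its entries are at
    -- most `p`.
    subTab-avoids : (∀ i → 1 ≤ i → i ≤ length μ → T i (get μ i) ≡ h → r ≤ i) → Avoids
    subTab-avoids min {p} last zero    _   = z≤n
    subTab-avoids min {p} last (suc j) j<r = +-mono-≤ (subTab-avoids min last j (<-trans (n<1+n j) j<r))
      (≤ν p (get μ (suc j)) (s≤s z≤n) ≤-refl λ { 1≤μj refl →
        let d = InD-intro {μ} (s≤s z≤n) 1≤μj ≤-refl in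
        s≤s⁻¹ (≤-trans (≤∧≢⇒< (proj₂ (range (suc j) (get μ (suc j)) d))
          (λ T≡h → <-irrefl refl (≤-trans j<r (min (suc j) (s≤s z≤n) (proj₁ (proj₂ d)) T≡h)))) (≤-reflexive (sym last))) })

    -- If `r` is the least element of R(μ,a), it is itself the greedy choice from row 1, and
    -- `ahead-below` applies to the very first search.
    lmin-avoids : r ≡ lmin μ a 1 → Avoids
    lmin-avoids r≡l {p} last = from (get a (suc p)) refl (part≥1 (≤-reflexive last))
      where
      -- The last part is generalized to `y` so that its positivity exposes it as `suc z`.
      from : ∀ y → y ≡ get a (suc p) → 1 ≤ y → ∀ j → j < r → psum (get μ) j ≤ psum (ν p) j
      from (suc z) y≡ _ = ahead-below {l = 1} μ≽ (ν-top p (<⇒≤ (≤-reflexive last))) ahead least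
        where
        μ≽ : μ ≽ (suc z ∷ take p a)
        μ≽ = subst (λ y → μ ≽ (y ∷ take p a)) (sym y≡) (Stage.shape (initial last))
        a≡ : a ≡ take p a ∷ʳ suc z
        a≡ = trans (a-last last) (cong (take p a ∷ʳ_) (sym y≡))
        least : ∀ x → 1 ≤ x → x < r → ¬ Removable (get μ) (z ∷ take p a) x
        least x 1≤x x<r rem = proj₂ (proj₂ (proj₂ (lmin-least μ a 1 (proj₁ r∈R) r∈R))) x 1≤x
          (subst (x <_) r≡l x<r) (subst (λ w → InR μ w x) (sym a≡) (removable⇒InR μ≽ rem))
        ahead : Ahead (get μ) 1 (ν p)
        ahead = record
          { below  = λ { zero _ → z≤n ; (suc j) (s≤s ()) }
          ; beyond = λ i _ → rowCount≤ μ T p i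
          ; nested = λ i 1≤i → ≤-trans
              (≤-reflexive (sym (trans (cong (λ q → ν q (suc i)) last) (ν-full (suc i) (s≤s z≤n)))))
              (ν-nested p i 1≤i)
          }

theorem5p6 : (n : ℕ) (μ a : List ℕ) (r : ℕ)
    → IsPartition n μ → IsComposition n a → μ ⊵ sortDesc a
    → InR μ a r → r ≤ sIdx μ a
    → (∀ i → i < n → InRFrom (μSeq μ a r i) (aSeq μ a r i)
    (if inA a i then 1 else lSeq μ a r i) (lSeq μ a r (suc i)))
    × IsLeast μ a (SubTab μ a r) (Stab n μ a r)
    × (r ≡ lmin μ a 1 → IsLeast μ a (STab μ a) (Stab n μ a r))
theorem5p6 n μ a r μ⊢n a⊨n μ⊵a r∈R r≤s =
    (λ i i<n → let s = proj₂ (proj₂ (step-at i<n)) in Step.inR s , Step.start≤ s)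
  , (S∈SubTab , λ T T∈ → S≤T T (proj₁ T∈) (subTab-avoids T (proj₁ T∈) (proj₂ T∈)))
  , λ r≡l → S∈STab , λ T T∈ → S≤T T T∈ (lmin-avoids T T∈ r≡l)
  where
  open Construction n μ a r μ⊢n a⊨n μ⊵a r∈R r≤s
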